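{- For all $w_1,w_2\in\mathfrak{h}^1_{>0}$ and every integer $n\ge 1$, the following identity holds in $\mathbb{Q}[[q]]$: \[ \zeta_q\bigl(d(\phi(w_1\,\overline{*}\,w_2))\circledast_q z_1^{n}\bigr)+\sum_{\substack{k+l=n\\ k,l\ge 1}}\zeta_q\bigl(d(\phi(w_1))\circledast_q z_1^{k}\bigr)\,\zeta_q\bigl(d(\phi(w_2))\circledast_q z_1^{l}\bigr)=0, \] where $z_1^{m}$ denotes the word $z_1z_1\cdots z_1$ ($m$ letters).
   Context: Let $\hbar$ be an indeterminate and $\mathcal{C}=\mathbb{Q}[\hbar]$. Let $\mathfrak{h}^1$ be the non-commutative polynomial algebra over $\mathcal{C}$ freely generated by letters $z_1,z_2,z_3,\dots$; juxtaposition denotes the concatenation product, a word is a monomial $z_{k_1}\cdots z_{k_r}$ ($r\ge 0$, the empty word being $1$). Let $\mathfrak{h}^1_{>0}$ be the $\mathcal{C}$-span of nonempty words, and $\mathfrak{h}^0$ the $\mathcal{C}$-span of $1$ and of the words $z_{k_1}\cdots z_{k_r}$ with $r\ge1$, $k_1\ge 2$. Let $\mathfrak{z}$ be the $\mathcal{C}$-span of $z_1,z_2,\dots$. Products on $\mathfrak{z}$ ($\mathcal{C}$-bilinear): $z_i\circ z_j=z_{i+j}$ and $z_i\circ_{+}z_j=z_{i+j}+\hbar z_{i+j-1}$. These give actions of $\mathfrak{z}$ on $\mathfrak{h}^1$: $z_i\circ 1=0$, $z_i\circ(z_jw)=(z_i\circ z_j)w$, and likewise $z_i\circ_+1=0$,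 $z_i\circ_+(z_jw)=(z_i\circ_+z_j)w$, for $i,j\ge1$, $w\in\mathfrak{h}^1$, extended $\mathcal{C}$-bilinearly. The $\mathcal{C}$-bilinear product $*_+$ on $\mathfrak{h}^1$: $1*_+w=w*_+1=w$ and $(z_iw_1)*_+(z_jw_2)=z_i(w_1*_+z_jw_2)+z_j(z_iw_1*_+w_2)+(z_i\circ_+z_j)(w_1*_+w_2)$. The $\mathcal{C}$-bilinear product $\overline{*}$ on $\mathfrak{h}^1$: $1\,\overline{*}\,w=w\,\overline{*}\,1=w$ and $(z_iw_1)\,\overline{*}\,(z_jw_2)=z_i(w_1\,\overline{*}\,z_jw_2)+z_j(z_iw_1\,\overline{*}\,w_2)-z_{i+j}(w_1\,\overline{*}\,w_2)$. The $\mathcal{C}$-bilinear product $\circledast_q$ on $\mathfrak{h}^1_{>0}$: $(z_iw_1)\circledast_q(z_jw_2)=z_{i+j}(w_1*_+w_2)$ for $i,j\ge1$, $w_1,w_2\in\mathfrak{h}^1$. The $\mathcal{C}$-linear map $d:\mathfrak{h}^1\to\mathfrak{h}^1$ is defined by $d(1)=1$, $d(z_iw)=z_i\,d(w)+z_i\circ d(w)$. The $\mathcal{C}$-linear map $\phi:\mathfrak{h}^1\to\mathfrak{h}^1$: for a word $u=z_{k_1}\cdots z_{k_r}$ of weight $K=k_1+\dots+k_r$, let $I_u=\{k_1+\dots+k_j:1\le j<r\}$ and $\{1,\dots,K\}\setminus I_u=\{p_1<\dots<p_l\}$; then $\phi(u)=z_{p_1}z_{p_2-p_1}\cdots z_{p_l-p_{l-1}}$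 (and $\phi(1)=1$). Let $[m]=(1-q^m)/(1-q)$. For a word $z_{k_1}\cdots z_{k_r}\in\mathfrak{h}^0$ set $\zeta_q(z_{k_1}\cdots z_{k_r})=\sum_{m_1>\dots>m_r>0}\frac{q^{(k_1-1)m_1+\cdots+(k_r-1)m_r}}{[m_1]^{k_1}\cdots[m_r]^{k_r}}\in\mathbb{Q}[[q]]$, $\zeta_q(1)=1$, and extend $\zeta_q$ to $\mathfrak{h}^0$ $\mathcal{C}$-linearly, with $\hbar$ acting on $\mathbb{Q}[[q]]$ as multiplication by $1-q$. -}

module Defs where

open import Data.Nat as ℕ using (ℕ; zero; suc; _∸_; _≤_; _≡ᵇ_; _≤ᵇ_)
open import Data.Nat.DivMod using (_%_)
open import Data.Bool using (Bool; true; false; if_then_else_; not)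
open import Data.List using (List; []; _∷_; map; concatMap; _++_; replicate; upTo; filter; [_])
open import Data.List.Relation.Unary.All using (All)
open import Data.Product using (_×_; _,_; proj₁; proj₂)
open import Data.Rational as ℚ using (ℚ; 0ℚ; 1ℚ)
open import Relation.Nullary.Decidable using (¬?)
open import Data.List.Membership.DecPropositional (ℕ._≟_) using (_∈?_)

-- The coefficient ring 𝒞 = ℚ[ħ] : lists of rationals, [c₀, c₁, …] = Σ cᵢ ħ^i

Poly : Set
Poly = List ℚ

polyAdd : Poly → Poly → Poly
polyAdd [] q = q
polyAdd p [] = p
polyAdd (a ∷ p) (b ∷ q) = (a ℚ.+ b) ∷ polyAdd p q

polyScale : ℚ → Poly → Poly
polyScale a = map (a ℚ.*_)

polyMul : Poly → Poly → Poly
polyMul [] q = []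
polyMul (a ∷ p) q = polyAdd (polyScale a q) (0ℚ ∷ polyMul p q)

pOne : Poly
pOne = 1ℚ ∷ []

pMinusOne : Poly
pMinusOne = ℚ.- 1ℚ ∷ []

pHbar : Poly
pHbar = 0ℚ ∷ 1ℚ ∷ []

-- Words and 𝔥¹.  A letter z_k is represented by the natural number k
-- (only k ≥ 1 are meaningful).  An element of 𝔥¹ is a finite formal
-- 𝒞-linear combination of words, represented as a list of
-- (coefficient, word) pairs, understood as their sum.

Word : Set
Word = List ℕ

H : Set
H = List (Poly × Word)

ValidWord : Word → Set
ValidWord w = All (λ k → 1 ≤ k) w

NonEmpty : Word → Set
NonEmpty [] = Data.Empty.⊥ where import Data.Empty
NonEmpty (_ ∷ _) = Data.Unit.⊤ where import Data.Unit

InH1pos : H → Set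
InH1pos h = All (λ t → NonEmpty (proj₂ t) × ValidWord (proj₂ t)) h

wordH : Word → H
wordH w = (pOne , w) ∷ []

scaleH : Poly → H → H
scaleH p = map (λ t → polyMul p (proj₁ t) , proj₂ t)

negH : H → H
negH = scaleH pMinusOne

prefixH : ℕ → H → H
prefixH i = map (λ t → proj₁ t , i ∷ proj₂ t)

bilin : (Word → Word → H) → H → H → H
bilin f x y = concatMap (λ s → concatMap (λ t →
  scaleH (polyMul (proj₁ s) (proj₁ t)) (f (proj₂ s) (proj₂ t))) y) x

lin : (Word → H) → H → H
lin f x = concatMap (λ s → scaleH (proj₁ s) (f (proj₂ s))) x

circW : ℕ → Word → H
circW i [] = []
circW i (j ∷ w) = wordH ((i ℕ.+ j) ∷ w)

circH : ℕ → H → H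
circH i = lin (circW i)

-- The product *₊ (on words), with z_i ∘₊ z_j = z_{i+j} + ħ z_{i+j-1}

starPlusW : Word → Word → H
starPlusW [] v = wordH v
starPlusW (i ∷ u) [] = wordH (i ∷ u)
starPlusW (i ∷ u) (j ∷ v) =
  prefixH i (starPlusW u (j ∷ v)) ++
  prefixH j (starPlusW (i ∷ u) v) ++
  prefixH (i ℕ.+ j) (starPlusW u v) ++
  scaleH pHbar (prefixH ((i ℕ.+ j) ∸ 1) (starPlusW u v))

starBarW : Word → Word → H
starBarW [] v = wordH v
starBarW (i ∷ u) [] = wordH (i ∷ u)
starBarW (i ∷ u) (j ∷ v) =
  prefixH i (starBarW u (j ∷ v)) ++
  prefixH j (starBarW (i ∷ u) v) ++
  negH (prefixH (i ℕ.+ j) (starBarW u v))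

starBar : H → H → H
starBar = bilin starBarW

-- The product ⊛_q on 𝔥¹_{>0}: (z_i w₁) ⊛ (z_j w₂) = z_{i+j} (w₁ *₊ w₂).
-- (Empty words do not lie in 𝔥¹_{>0}; they are sent to 0, a junk value
-- that never occurs in the theorem.)
circledastW : Word → Word → H
circledastW (i ∷ u) (j ∷ v) = prefixH (i ℕ.+ j) (starPlusW u v)
circledastW _ _ = []

circledast : H → H → H
circledast = bilin circledastW

dW : Word → H
dW [] = wordH []
dW (i ∷ w) = prefixH i (dW w) ++ circH i (dW w)

d : H → H
d = lin dW

partialSums : ℕ → Word → List ℕ
partialSums acc [] = []
partialSums acc (k ∷ []) = []
partialSums acc (k ∷ k' ∷ ks) = (acc ℕ.+ k) ∷ partialSums (acc ℕ.+ k) (k' ∷ ks)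

weight : Word → ℕ
weight [] = 0
weight (k ∷ w) = k ℕ.+ weight w

diffs : ℕ → List ℕ → Word
diffs prev [] = []
diffs prev (p ∷ ps) = (p ∸ prev) ∷ diffs p ps

phiW : Word → Word
phiW u = diffs 0 (filter (λ p → ¬? (p ∈? partialSums 0 u)) (map suc (upTo (weight u))))

phi : H → H
phi = lin (λ u → wordH (phiW u))

z1pow : ℕ → H
z1pow m = wordH (replicate m 1)

-- Formal power series ℚ[[q]] as coefficient sequences

PS : Set
PS = ℕ → ℚ

zeroPS : PS
zeroPS _ = 0ℚ

onePS : PS
onePS zero = 1ℚ
onePS (suc _) = 0ℚ

_⊕_ : PS → PS → PS
(f ⊕ g) n = f n ℚ.+ g n

sumTo : ℕ → (ℕ → ℚ) → ℚ
sumTo zero a = a 0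
sumTo (suc n) a = sumTo n a ℚ.+ a (suc n)

_⊗_ : PS → PS → PS
(f ⊗ g) n = sumTo n (λ i → f i ℚ.* g (n ∸ i))

powPS : PS → ℕ → PS
powPS f zero = onePS
powPS f (suc k) = f ⊗ powPS f k

constPS : ℚ → PS
constPS c zero = c
constPS c (suc _) = 0ℚ

qpow : ℕ → PS
qpow e n = if n ≡ᵇ e then 1ℚ else 0ℚ

oneMinusQ : PS
oneMinusQ zero = 1ℚ
oneMinusQ (suc zero) = ℚ.- 1ℚ
oneMinusQ (suc (suc _)) = 0ℚ

-- 1/(1 - q^m) = Σ_j q^{mj}  (m ≥ 1; m = 0 is junk)
geom : ℕ → PS
geom zero _ = 0ℚ
geom (suc m) n = if (n % suc m) ≡ᵇ 0 then 1ℚ else 0ℚ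

-- 1/[m] = (1-q)/(1-q^m)
invBracket : ℕ → PS
invBracket m = oneMinusQ ⊗ geom m

-- image of a polynomial in ħ, with ħ acting as 1 - q
evalPoly : Poly → PS
evalPoly [] = zeroPS
evalPoly (c ∷ p) = constPS c ⊕ (oneMinusQ ⊗ evalPoly p)

sumPS : List PS → PS
sumPS [] = zeroPS
sumPS (f ∷ fs) = f ⊕ sumPS fs

-- Zb w b = Σ_{b ≥ m₁ > … > m_r > 0} q^{Σ(kᵢ-1)mᵢ} / Π [mᵢ]^{kᵢ}
Zb : Word → ℕ → PS
Zb [] b = onePS
Zb (k ∷ w) zero = zeroPS
Zb (k ∷ w) (suc b) =
  Zb (k ∷ w) b ⊕ ((qpow ((k ∸ 1) ℕ.* suc b) ⊗ powPS (invBracket (suc b)) k) ⊗ Zb w b)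

-- ζ_q on a word of 𝔥⁰.  For k₁ ≥ 2 the summand indexed by m₁ has
-- q-adic valuation ≥ (k₁-1)m₁ ≥ m₁, so the coefficient of q^N of the
-- infinite sum equals that of the partial sum over m₁ ≤ N.
-- Words not in 𝔥⁰ (first letter < 2) get the junk value 0; they never
-- occur in the theorem.
zetaW : Word → PS
zetaW [] = onePS
zetaW (k ∷ w) with 2 ≤ᵇ k
... | true = λ N → Zb (k ∷ w) N N
... | false = zeroPS

zetaq : H → PS
zetaq h = sumPS (map (λ t → evalPoly (proj₁ t) ⊗ zetaW (proj₂ t)) h)

sumFrom1Below : ℕ → (ℕ → PS) → PS
sumFrom1Below n f = sumPS (map (λ i → f (suc i)) (upTo (n ∸ 1)))

{-# OPTIONS --safe #-}

-- Let p_m = q^m/[m], let A_m(x) = x p_m ∏_{l<m} (1 + x/[l]), and let s_m(w) be the part of ζ_q(d(φ(w)))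
-- with largest summation index m.  By the *₊-product formula for truncated sums, ζ_q(d(φ(w)) ⊛ z_1^n)
-- is the coefficient of x^n in F_w(x) = ∑_m s_m(w) A_m(x).
-- At x = -[N] this series is a finite q-binomial transform, which turns multiplication by p into
-- partial summation and conversely; hence, φ being the duality that swaps these two operations,
-- F_w(-[N]) = - ∑_{N ≥ m_1 ≥ … ≥ m_r ≥ 1} ∏ p_{m_i}^{k_i}, and the sum on the right is multiplicative
-- for the product starBar.
-- So P = F_{w₁ starBar w₂} + F_{w₁} F_{w₂}, truncated at m ≤ M, vanishes at x = -[N] for 0 ≤ N ≤ M.
-- The coefficient of x^n in P is divisible by q^n, and dividing out a root gains one more factor q in
-- every coefficient, so P is divisible by q^(M+1).
module Submission where

open import Defs
open import Algebra.Bundles using (CommutativeRing; RawRing)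
import Algebra.Properties.CommutativeSemigroup as CommutativeSemigroupProperties
import Algebra.Properties.CommutativeSemiring.Exp as CommutativeSemiringExp
import Algebra.Properties.Monoid.Mult as Mult
import Algebra.Properties.Monoid.Mult.TCOptimised as MultTC
import Algebra.Properties.Ring as RingProperties
import Algebra.Properties.Semiring.Exp as SemiringExp
import Algebra.Properties.Semiring.Mult as SemiringMult
import Algebra.Solver.Ring as RingSolver
import Algebra.Solver.Ring.AlmostCommutativeRing as ACR
open import Data.Empty using (⊥)
open import Data.List using (List; []; _∷_; _++_; map; concatMap; filter; replicate; applyUpTo; upTo)
open import Data.List.Membership.Propositional using (_∈_; _∉_)
open import Data.List.Membership.Propositional.Properties using (∈-map⁺; ∈-map⁻)
open import Data.List.Properties using (map-upTo; filter-accept; filter-reject)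
open import Data.List.Relation.Unary.All as All using (All; []; _∷_)
open import Data.List.Relation.Unary.All.Properties using (++⁺)
open import Data.Maybe using (Maybe; just; nothing)
open import Data.Nat as ℕ using (ℕ; zero; suc; _≤_; _<_; _∸_; z≤n; s≤s)
open import Data.List.Membership.DecPropositional ℕ._≟_ using (_∈?_)
open import Data.Nat.DivMod using ([m+n]%n≡m%n; m<n⇒m%n≡m)
import Data.Nat.Properties as ℕₚ
open import Data.Product using (_×_; _,_; proj₁; proj₂; ∃)
open import Data.Product.Properties using (≡-dec)
open import Data.Rational as ℚ using (ℚ; 0ℚ; 1ℚ)
import Data.Rational.Properties as ℚₚ
open import Data.Sum using (inj₁; inj₂)
open import Data.Unit using (⊤; tt)
open import Function using (_∘_)
open import Level using (0ℓ)
open import Relation.Binary.PropositionalEquality as ≡ using (_≡_)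
import Relation.Binary.Reasoning.Setoid as SetoidReasoning
open import Relation.Nullary using (yes; no; ¬?)

-- Why the points -[N]: for N ≥ 1 the factor 1 + x/[N] kills A_m for every m > N, so F_w(-[N]) is a
-- finite sum that truncation at M ≥ N does not change. Since [l] - [N] = -q^l [N-l], the surviving
-- values are, up to sign and a power of q, Gaussian binomial coefficients, and their Pascal and
-- absorption rules carry the whole transform. The sum over k + l = n with k, l ≥ 1 is a full Cauchy
-- product because F_w has no constant term. The obstacle is the way back from values to
-- coefficients: two of the points differ by a unit times a power of q, so interpolating through
-- them would bring in negative powers of q. Hence roots are divided out one at a time, and their
-- differences are only cancelled from equations, never inverted. Up to the generating polynomials
-- everything holds in an abstract `QRing`, where each [m] with m ≥ 1 is invertible and q can be
-- cancelled; ℚ[[q]] is one instance. Indices are stored from 0: `ι m`, `p m` and `Top w m` belong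
-- to the summation index m + 1.

-- Normalising identities over an arbitrary commutative ring

module Solver (R : CommutativeRing 0ℓ 0ℓ) where
  open CommutativeRing R hiding (zero)
  open Mult +-monoid using (×-homo-+) renaming (_×_ to _·_)
  open SemiringMult semiring using (×1-homo-*)
  open SetoidReasoning setoid
  module RP = RingProperties ring
  open CommutativeSemigroupProperties +-commutativeSemigroup using () renaming (interchange to medial)

  open MultTC +-monoid using (×ᵤ≈×) renaming (_×_ to _·′_)

  difference : ℕ × ℕ → Carrier
  difference (a , b) = (a · 1#) - (b · 1#)

  -- Unlike difference, this sends (0 , 0) and (1 , 0) to 0# and 1# definitionally.
  ⟦_⟧ᶜ : ℕ × ℕ → Carrier
  ⟦ a , zero ⟧ᶜ = a ·′ 1#
  ⟦ a , suc b ⟧ᶜ = difference (a , suc b)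

  ⟦⟧ᶜ≈difference : ∀ x → ⟦ x ⟧ᶜ ≈ difference x
  ⟦⟧ᶜ≈difference (a , zero) =
    trans (sym (×ᵤ≈× a 1#)) (sym (trans (+-congˡ RP.-0#≈0#) (+-identityʳ _)))
  ⟦⟧ᶜ≈difference (a , suc b) = refl

  cancel : ℕ × ℕ → ℕ × ℕ
  cancel (suc a , suc b) = cancel (a , b)
  cancel x = x

  -- The integers as formal differences of naturals; cancel makes the representation unique,
  -- which the solver needs because it compares normal forms definitionally.
  coefficients : RawRing 0ℓ 0ℓ
  coefficients = record
    { Carrier = ℕ × ℕ
    ; _≈_ = _≡_
    ; _+_ = λ (a , b) (c , d) → cancel (a ℕ.+ c , b ℕ.+ d)
    ; _*_ = λ (a , b) (c , d) → cancel (a ℕ.* c ℕ.+ b ℕ.* d , a ℕ.* d ℕ.+ b ℕ.* c)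
    ; -_ = λ (a , b) → b , a
    ; 0# = 0 , 0
    ; 1# = 1 , 0
    }

  interchange : ∀ a b c d → (a + b) - (c + d) ≈ (a - c) + (b - d)
  interchange a b c d = begin
    (a + b) - (c + d)        ≈⟨ +-congˡ (RP.-‿+-comm c d) ⟨
    (a + b) + (- c + - d)    ≈⟨ medial a b (- c) (- d) ⟩
    (a - c) + (b - d)        ∎

  product-of-differences : ∀ a b c d → (a * c + b * d) - (a * d + b * c) ≈ (a - b) * (c - d)
  product-of-differences a b c d = begin
    (a * c + b * d) - (a * d + b * c)          ≈⟨ interchange _ _ _ _ ⟩
    (a * c - a * d) + (b * d - b * c)          ≈⟨ +-cong (RP.x[y-z]≈xy-xz a c d) flip ⟨
    a * (c - d) + (- b) * (c - d)              ≈⟨ distribʳ _ _ _ ⟨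
    (a - b) * (c - d)                          ∎
    where
    flip : (- b) * (c - d) ≈ b * d - b * c
    flip = begin
      (- b) * (c - d)    ≈⟨ RP.-‿distribˡ-* b (c - d) ⟨
      - (b * (c - d))    ≈⟨ -‿cong (RP.x[y-z]≈xy-xz b c d) ⟩
      - (b * c - b * d)  ≈⟨ RP.⁻¹-anti-homo‿- (b * c) (b * d) ⟩
      b * d - b * c      ∎

  ⟦cancel⟧≈difference : ∀ x → ⟦ cancel x ⟧ᶜ ≈ difference x
  ⟦cancel⟧≈difference (suc a , suc b) = begin
    ⟦ cancel (a , b) ⟧ᶜ                  ≈⟨ ⟦cancel⟧≈difference (a , b) ⟩
    difference (a , b)                   ≈⟨ +-identityˡ _ ⟨
    0# + difference (a , b)              ≈⟨ +-congʳ (-‿inverseʳ 1#) ⟨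
    (1# - 1#) + difference (a , b)       ≈⟨ interchange _ _ _ _ ⟨
    difference (suc a , suc b)           ∎
  ⟦cancel⟧≈difference x@(zero , _) = ⟦⟧ᶜ≈difference x
  ⟦cancel⟧≈difference x@(suc _ , zero) = ⟦⟧ᶜ≈difference x

  morphism : coefficients ACR.-Raw-AlmostCommutative⟶ ACR.fromCommutativeRing R
  morphism = record
    { ⟦_⟧ = ⟦_⟧ᶜ
    ; +-homo = λ x@(a , b) y@(c , d) → begin
        ⟦ cancel (a ℕ.+ c , b ℕ.+ d) ⟧ᶜ                   ≈⟨ ⟦cancel⟧≈difference (a ℕ.+ c , b ℕ.+ d) ⟩
        ((a ℕ.+ c) · 1#) - ((b ℕ.+ d) · 1#)                ≈⟨ +-cong (×-homo-+ 1# a c) (-‿cong (×-homo-+ 1# b d)) ⟩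
        ((a · 1#) + (c · 1#)) - ((b · 1#) + (d · 1#))      ≈⟨ interchange _ _ _ _ ⟩
        difference x + difference y                        ≈⟨ +-cong (⟦⟧ᶜ≈difference x) (⟦⟧ᶜ≈difference y) ⟨
        ⟦ x ⟧ᶜ + ⟦ y ⟧ᶜ                                    ∎
    ; *-homo = λ x@(a , b) y@(c , d) → begin
        ⟦ cancel (a ℕ.* c ℕ.+ b ℕ.* d , a ℕ.* d ℕ.+ b ℕ.* c) ⟧ᶜ
          ≈⟨ ⟦cancel⟧≈difference (a ℕ.* c ℕ.+ b ℕ.* d , a ℕ.* d ℕ.+ b ℕ.* c) ⟩
        difference (a ℕ.* c ℕ.+ b ℕ.* d , a ℕ.* d ℕ.+ b ℕ.* c)
          ≈⟨ +-cong (sum-of-products a c b d) (-‿cong (sum-of-products a d b c)) ⟩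
        ((a · 1#) * (c · 1#) + (b · 1#) * (d · 1#)) - ((a · 1#) * (d · 1#) + (b · 1#) * (c · 1#))
          ≈⟨ product-of-differences _ _ _ _ ⟩
        difference x * difference y
          ≈⟨ *-cong (⟦⟧ᶜ≈difference x) (⟦⟧ᶜ≈difference y) ⟨
        ⟦ x ⟧ᶜ * ⟦ y ⟧ᶜ ∎
    ; -‿homo = λ x@(a , b) → begin
        ⟦ b , a ⟧ᶜ       ≈⟨ ⟦⟧ᶜ≈difference (b , a) ⟩
        difference (b , a)     ≈⟨ RP.⁻¹-anti-homo‿- (a · 1#) (b · 1#) ⟨
        - difference x   ≈⟨ -‿cong (⟦⟧ᶜ≈difference x) ⟨
        - ⟦ x ⟧ᶜ         ∎
    ; 0-homo = refl
    ; 1-homo = refl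
    }
    where
    sum-of-products : ∀ a c b d →
      (a ℕ.* c ℕ.+ b ℕ.* d) · 1# ≈ (a · 1#) * (c · 1#) + (b · 1#) * (d · 1#)
    sum-of-products a c b d =
      trans (×-homo-+ 1# (a ℕ.* c) (b ℕ.* d)) (+-cong (×1-homo-* a c) (×1-homo-* b d))

  _≟ᶜ_ : ∀ x y → Maybe (⟦ x ⟧ᶜ ≈ ⟦ y ⟧ᶜ)
  x ≟ᶜ y with ≡-dec ℕ._≟_ ℕ._≟_ x y
  ... | yes x≡y = just (reflexive (≡.cong ⟦_⟧ᶜ x≡y))
  ... | no _ = nothing

  open RingSolver coefficients (ACR.fromCommutativeRing R) morphism _≟ᶜ_ public
    using (solve; _:=_; _:+_; _:*_; _:-_; :-_; con)

-- Finite sums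

module Sums (R : CommutativeRing 0ℓ 0ℓ) where
  open CommutativeRing R hiding (zero)
  open Solver R

  ∑ : ℕ → (ℕ → Carrier) → Carrier
  ∑ zero f = 0#
  ∑ (suc n) f = ∑ n f + f n

  ∑-cong-below : ∀ n {f g : ℕ → Carrier} → (∀ i → i < n → f i ≈ g i) → ∑ n f ≈ ∑ n g
  ∑-cong-below zero h = refl
  ∑-cong-below (suc n) h =
    +-cong (∑-cong-below n (λ i i<n → h i (ℕₚ.m<n⇒m<1+n i<n))) (h n (ℕₚ.n<1+n n))

  ∑-cong : ∀ n {f g : ℕ → Carrier} → (∀ i → f i ≈ g i) → ∑ n f ≈ ∑ n g
  ∑-cong n h = ∑-cong-below n (λ i _ → h i)

  ∑-zero : ∀ n → ∑ n (λ _ → 0#) ≈ 0#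
  ∑-zero zero = refl
  ∑-zero (suc n) = trans (+-identityʳ _) (∑-zero n)

  ∑-+ : ∀ n (f g : ℕ → Carrier) → ∑ n (λ i → f i + g i) ≈ ∑ n f + ∑ n g
  ∑-+ zero f g = sym (+-identityʳ 0#)
  ∑-+ (suc n) f g = trans (+-congʳ (∑-+ n f g))
    (solve 4 (λ a b c d → (a :+ b) :+ (c :+ d) := (a :+ c) :+ (b :+ d)) refl _ _ _ _)

  ∑-*ˡ : ∀ n c (f : ℕ → Carrier) → ∑ n (λ i → c * f i) ≈ c * ∑ n f
  ∑-*ˡ zero c f = sym (zeroʳ c)
  ∑-*ˡ (suc n) c f = trans (+-congʳ (∑-*ˡ n c f)) (sym (distribˡ c _ _))

  ∑-head : ∀ n (f : ℕ → Carrier) → ∑ (suc n) f ≈ f 0 + ∑ n (f ∘ suc)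
  ∑-head zero f = +-comm 0# (f 0)
  ∑-head (suc n) f = trans (+-congʳ (∑-head n f)) (+-assoc _ _ _)

  -- Abel summation. The boundary term stays explicit; where this is used it vanishes, because there
  -- `a n` is a Gaussian binomial out of range.
  ∑-summation-by-parts : ∀ n (a s : ℕ → Carrier) →
    ∑ n (λ j → (a j - a (suc j)) * ∑ j s) ≈ ∑ n (λ j → s j * a (suc j)) - a n * ∑ n s
  ∑-summation-by-parts zero a s =
    solve 1 (λ x → con (0 , 0) := con (0 , 0) :- x :* con (0 , 0)) refl (a 0)
  ∑-summation-by-parts (suc n) a s = trans (+-congʳ (∑-summation-by-parts n a s))
    (solve 5 (λ T x y S z → T :- x :* S :+ (x :- y) :* S := T :+ z :* y :- y :* (S :+ z))
      refl _ (a n) (a (suc n)) (∑ n s) (s n))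

  ∑-telescope : ∀ n (a : ℕ → Carrier) → ∑ n (λ j → a j - a (suc j)) ≈ a 0 - a n
  ∑-telescope zero a = sym (-‿inverseʳ (a 0))
  ∑-telescope (suc n) a = trans (+-congʳ (∑-telescope n a))
    (solve 3 (λ x y z → x :- y :+ (y :- z) := x :- z) refl _ _ _)

-- Polynomials and division by a linear factor

module Polynomials (R : CommutativeRing 0ℓ 0ℓ) where
  open CommutativeRing R hiding (zero)
  open Solver R
  open Sums R
  open SetoidReasoning setoid

  Polynomial : Set
  Polynomial = List Carrier

  infixl 6 _⊞_
  infixl 7 _⊠_ _◃_

  _⊞_ : Polynomial → Polynomial → Polynomial
  [] ⊞ Q = Q
  (a ∷ P) ⊞ [] = a ∷ P
  (a ∷ P) ⊞ (b ∷ Q) = (a + b) ∷ (P ⊞ Q)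

  _◃_ : Carrier → Polynomial → Polynomial
  c ◃ [] = []
  c ◃ (a ∷ P) = (c * a) ∷ (c ◃ P)

  _⊠_ : Polynomial → Polynomial → Polynomial
  [] ⊠ Q = []
  (a ∷ P) ⊠ Q = (a ◃ Q) ⊞ (0# ∷ (P ⊠ Q))

  eval : Carrier → Polynomial → Carrier
  eval x [] = 0#
  eval x (a ∷ P) = a + x * eval x P

  eval-⊞ : ∀ x P Q → eval x (P ⊞ Q) ≈ eval x P + eval x Q
  eval-⊞ x [] Q = sym (+-identityˡ _)
  eval-⊞ x (a ∷ P) [] = sym (+-identityʳ _)
  eval-⊞ x (a ∷ P) (b ∷ Q) = trans (+-congˡ (*-congˡ (eval-⊞ x P Q)))
    (solve 5 (λ a b x p q → (a :+ b) :+ x :* (p :+ q) := (a :+ x :* p) :+ (b :+ x :* q)) refl _ _ _ _ _)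

  eval-◃ : ∀ x c P → eval x (c ◃ P) ≈ c * eval x P
  eval-◃ x c [] = sym (zeroʳ c)
  eval-◃ x c (a ∷ P) = trans (+-congˡ (*-congˡ (eval-◃ x c P)))
    (solve 4 (λ c a x p → c :* a :+ x :* (c :* p) := c :* (a :+ x :* p)) refl _ _ _ _)

  eval-⊠ : ∀ x P Q → eval x (P ⊠ Q) ≈ eval x P * eval x Q
  eval-⊠ x [] Q = sym (zeroˡ _)
  eval-⊠ x (a ∷ P) Q = begin
    eval x ((a ◃ Q) ⊞ (0# ∷ (P ⊠ Q)))            ≈⟨ eval-⊞ x (a ◃ Q) _ ⟩
    eval x (a ◃ Q) + (0# + x * eval x (P ⊠ Q))   ≈⟨ +-cong (eval-◃ x a Q) (+-congˡ (*-congˡ (eval-⊠ x P Q))) ⟩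
    a * eval x Q + (0# + x * (eval x P * eval x Q))
      ≈⟨ solve 4 (λ a x p q → a :* q :+ (con (0 , 0) :+ x :* (p :* q)) := (a :+ x :* p) :* q) refl _ _ _ _ ⟩
    (a + x * eval x P) * eval x Q                ∎

  coef : Polynomial → ℕ → Carrier
  coef [] n = 0#
  coef (a ∷ P) zero = a
  coef (a ∷ P) (suc n) = coef P n

  coef-⊞ : ∀ P Q n → coef (P ⊞ Q) n ≈ coef P n + coef Q n
  coef-⊞ [] Q n = sym (+-identityˡ _)
  coef-⊞ (a ∷ P) [] n = sym (+-identityʳ _)
  coef-⊞ (a ∷ P) (b ∷ Q) zero = refl
  coef-⊞ (a ∷ P) (b ∷ Q) (suc n) = coef-⊞ P Q n

  coef-◃ : ∀ c P n → coef (c ◃ P) n ≈ c * coef P n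
  coef-◃ c [] n = sym (zeroʳ c)
  coef-◃ c (a ∷ P) zero = refl
  coef-◃ c (a ∷ P) (suc n) = coef-◃ c P n

  coef-⊠ : ∀ P Q n → coef (P ⊠ Q) n ≈ ∑ (suc n) (λ k → coef P k * coef Q (n ∸ k))
  coef-⊠ [] Q n = sym (trans (∑-cong (suc n) (λ k → zeroˡ _)) (∑-zero (suc n)))
  coef-⊠ (a ∷ P) Q n = begin
    coef ((a ◃ Q) ⊞ (0# ∷ (P ⊠ Q))) n             ≈⟨ coef-⊞ (a ◃ Q) _ n ⟩
    coef (a ◃ Q) n + coef (0# ∷ (P ⊠ Q)) n        ≈⟨ +-cong (coef-◃ a Q n) (shifted n) ⟩
    a * coef Q n + ∑ n (λ k → coef P k * coef Q (n ∸ suc k))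
                                                  ≈⟨ ∑-head n (λ k → coef (a ∷ P) k * coef Q (n ∸ k)) ⟨
    ∑ (suc n) (λ k → coef (a ∷ P) k * coef Q (n ∸ k)) ∎
    where
    shifted : ∀ n → coef (0# ∷ (P ⊠ Q)) n ≈ ∑ n (λ k → coef P k * coef Q (n ∸ suc k))
    shifted zero = refl
    shifted (suc n) = coef-⊠ P Q n

  -- Synthetic division by x - r, with remainder `eval r P`. The result is as long as P, so for
  -- nonempty P its last entry is a padding zero.
  quotient : Carrier → Polynomial → Polynomial
  quotient r [] = []
  quotient r (a ∷ P) = eval r P ∷ quotient r P

  eval-quotient : ∀ r x P → eval x P ≈ (x - r) * eval x (quotient r P) + eval r P
  eval-quotient r x [] = solve 1 (λ y → con (0 , 0) := y :* con (0 , 0) :+ con (0 , 0)) refl (x - r)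
  eval-quotient r x (a ∷ P) = trans (+-congˡ (*-congˡ (eval-quotient r x P)))
    (solve 5 (λ a x r s e → a :+ x :* ((x :- r) :* s :+ e) := (x :- r) :* (e :+ x :* s) :+ (a :+ r :* e))
      refl _ _ _ _ _)

  -- P = (x - r) Q + P(r) read off coefficientwise. It does not follow from `eval-quotient`, since
  -- over a general ring values do not determine coefficients.
  coef-quotient : ∀ r P n → coef P n ≈
    coef (0# ∷ quotient r P) n - r * coef (quotient r P) n + coef (eval r P ∷ []) n
  coef-quotient r [] zero = solve 1 (λ r → con (0 , 0) := con (0 , 0) :- r :* con (0 , 0) :+ con (0 , 0)) refl r
  coef-quotient r [] (suc n) = solve 1 (λ r → con (0 , 0) := con (0 , 0) :- r :* con (0 , 0) :+ con (0 , 0)) refl r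
  coef-quotient r (a ∷ P) zero =
    solve 3 (λ r a e → a := con (0 , 0) :- r :* e :+ (a :+ r :* e)) refl r a (eval r P)
  coef-quotient r (a ∷ P) (suc zero) = trans (coef-quotient r P zero)
    (solve 3 (λ r x e → con (0 , 0) :- r :* x :+ e := e :- r :* x :+ con (0 , 0)) refl r _ _)
  coef-quotient r (a ∷ P) (suc (suc n)) = coef-quotient r P (suc n)

-- Divisibility of coefficients by powers of q

module Divisibility (R : CommutativeRing 0ℓ 0ℓ) (q : CommutativeRing.Carrier R) where
  open CommutativeRing R hiding (zero)
  open Solver R
  open Polynomials R
  open SetoidReasoning setoid
  open SemiringExp semiring using (_^_; ^-homo-*)

  infix 4 q^_∣_

  q^_∣_ : ℕ → Carrier → Set
  q^ k ∣ x = ∃ λ y → x ≈ q ^ k * y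

  ∣-resp : ∀ k {x y} → x ≈ y → q^ k ∣ x → q^ k ∣ y
  ∣-resp k x≈y (z , e) = z , trans (sym x≈y) e

  ∣-zero : ∀ k → q^ k ∣ 0#
  ∣-zero k = 0# , sym (zeroʳ _)

  ∣-+ : ∀ k {x y} → q^ k ∣ x → q^ k ∣ y → q^ k ∣ x + y
  ∣-+ k (u , e) (v , f) = u + v , trans (+-cong e f) (sym (distribˡ _ u v))

  ∣-neg : ∀ k {x} → q^ k ∣ x → q^ k ∣ - x
  ∣-neg k (u , e) = - u , trans (-‿cong e) (solve 2 (λ t u → :- (t :* u) := t :* (:- u)) refl (q ^ k) u)

  ∣-* : ∀ k l {x y} → q^ k ∣ x → q^ l ∣ y → q^ (k ℕ.+ l) ∣ x * y
  ∣-* k l {x} {y} (u , e) (v , f) = u * v , (begin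
    x * y                          ≈⟨ *-cong e f ⟩
    (q ^ k * u) * (q ^ l * v)      ≈⟨ solve 4 (λ s u t v → (s :* u) :* (t :* v) := (s :* t) :* (u :* v)) refl _ _ _ _ ⟩
    (q ^ k * q ^ l) * (u * v)      ≈⟨ *-congʳ (^-homo-* q k l) ⟨
    q ^ (k ℕ.+ l) * (u * v)        ∎)

  ∣-*ˡ : ∀ k x {y} → q^ k ∣ y → q^ k ∣ x * y
  ∣-*ˡ k x (u , e) = x * u , trans (*-congˡ e) (solve 3 (λ x t u → x :* (t :* u) := t :* (x :* u)) refl _ _ _)

  ∣-weaken : ∀ k {x} → q^ suc k ∣ x → q^ k ∣ x
  ∣-weaken k (u , e) = q * u , trans e (solve 3 (λ q t u → (q :* t) :* u := t :* (q :* u)) refl _ _ _)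

  -- Tilted k P : the coefficient of xⁿ in P is divisible by q^(k + n).
  Tilted : ℕ → Polynomial → Set
  Tilted k [] = ⊤
  Tilted k (a ∷ P) = q^ k ∣ a × Tilted (suc k) P

  tilted-⊞ : ∀ k P Q → Tilted k P → Tilted k Q → Tilted k (P ⊞ Q)
  tilted-⊞ k [] Q tP tQ = tQ
  tilted-⊞ k (a ∷ P) [] tP tQ = tP
  tilted-⊞ k (a ∷ P) (b ∷ Q) (ta , tP) (tb , tQ) = ∣-+ k ta tb , tilted-⊞ (suc k) P Q tP tQ

  tilted-◃ : ∀ k l c P → q^ k ∣ c → Tilted l P → Tilted (k ℕ.+ l) (c ◃ P)
  tilted-◃ k l c [] tc tP = tt
  tilted-◃ k l c (a ∷ P) tc (ta , tP) = ∣-* k l tc ta ,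
    ≡.subst (λ m → Tilted m (c ◃ P)) (ℕₚ.+-suc k l) (tilted-◃ k (suc l) c P tc tP)

  tilted-⊠ : ∀ k l P Q → Tilted k P → Tilted l Q → Tilted (k ℕ.+ l) (P ⊠ Q)
  tilted-⊠ k l [] Q tP tQ = tt
  tilted-⊠ k l (a ∷ P) Q (ta , tP) tQ =
    tilted-⊞ (k ℕ.+ l) (a ◃ Q) (0# ∷ (P ⊠ Q)) (tilted-◃ k l a Q ta tQ)
      (∣-zero (k ℕ.+ l) , tilted-⊠ (suc k) l P Q tP tQ)

  tilted-eval : ∀ k r P → Tilted k P → q^ k ∣ eval r P
  tilted-eval k r [] tP = ∣-zero k
  tilted-eval k r (a ∷ P) (ta , tP) = ∣-+ k ta (∣-*ˡ k r (∣-weaken k (tilted-eval (suc k) r P tP)))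

  -- Coefficient n of the quotient is built from the coefficients of P with index at least n + 1,
  -- and these carry one more power of q than coefficient n.
  tilted-quotient : ∀ k r P → Tilted k P → Tilted (suc k) (quotient r P)
  tilted-quotient k r [] tP = tt
  tilted-quotient k r (a ∷ P) (ta , tP) = tilted-eval (suc k) r P tP , tilted-quotient (suc k) r P tP

  tilted-coef : ∀ k P n → Tilted k P → q^ k ∣ coef P n
  tilted-coef k [] n tP = ∣-zero k
  tilted-coef k (a ∷ P) zero (ta , tP) = ta
  tilted-coef k (a ∷ P) (suc n) (ta , tP) = ∣-weaken k (tilted-coef (suc k) P n tP)

  -- Each root that is divided out raises the tilt by one.
  coef-divisible-by-roots : (r : ℕ → Carrier) →
    (∀ i j x → (r (suc (i ℕ.+ j)) - r i) * x ≈ 0# → x ≈ 0#) →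
    ∀ M i k P → Tilted k P → (∀ j → j < M → eval (r (i ℕ.+ j)) P ≈ 0#) → ∀ n → q^ (k ℕ.+ M) ∣ coef P n
  coef-divisible-by-roots r cancel zero i k P tP zeros n =
    ≡.subst (q^_∣ coef P n) (≡.sym (ℕₚ.+-identityʳ k)) (tilted-coef k P n tP)
  coef-divisible-by-roots r cancel (suc M) i k P tP zeros n =
    ∣-resp K (sym (coef-quotient (r i) P n))
      (∣-+ K (∣-+ K (shift n) (∣-neg K (∣-*ˡ K (r i) (divides n)))) (remainder n))
    where
    K : ℕ
    K = k ℕ.+ suc M

    Q : Polynomial
    Q = quotient (r i) P

    root : eval (r i) P ≈ 0#
    root = ≡.subst (λ m → eval (r m) P ≈ 0#) (ℕₚ.+-identityʳ i) (zeros 0 (s≤s z≤n))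

    -- At a later root both P and the remainder vanish, so (x - r i) times the value of Q is 0;
    -- `cancel` does here what the absence of zero divisors would do in a domain.
    zeros′ : ∀ j → j < M → eval (r (suc i ℕ.+ j)) Q ≈ 0#
    zeros′ j j<M = cancel i j _ (begin
      (x - r i) * eval x Q                    ≈⟨ +-identityʳ _ ⟨
      (x - r i) * eval x Q + 0#               ≈⟨ +-congˡ root ⟨
      (x - r i) * eval x Q + eval (r i) P     ≈⟨ eval-quotient (r i) x P ⟨
      eval x P                                ≈⟨ ≡.subst (λ m → eval (r m) P ≈ 0#) (ℕₚ.+-suc i j) (zeros (suc j) (s≤s j<M)) ⟩
      0#                                      ∎)
      where
      x : Carrier
      x = r (suc i ℕ.+ j)

    divides : ∀ n → q^ K ∣ coef Q n
    divides n = ≡.subst (q^_∣ coef Q n) (≡.sym (ℕₚ.+-suc k M))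
      (coef-divisible-by-roots r cancel M (suc i) (suc k) Q (tilted-quotient k (r i) P tP) zeros′ n)

    shift : ∀ n → q^ K ∣ coef (0# ∷ Q) n
    shift zero = ∣-zero K
    shift (suc n) = divides n

    remainder : ∀ n → q^ K ∣ coef (eval (r i) P ∷ []) n
    remainder zero = ∣-resp K (sym root) (∣-zero K)
    remainder (suc n) = ∣-zero K

-- q-integers and the interface of the coefficient ring

module Bracket (R : CommutativeRing 0ℓ 0ℓ) (q : CommutativeRing.Carrier R) where
  open CommutativeRing R hiding (zero)
  open Solver R
  open SemiringExp semiring using (_^_)

  -- The q-integer [m] by Horner's rule, so that nothing is divided by 1 - q.
  bracket : ℕ → Carrier
  bracket zero = 0#
  bracket (suc m) = 1# + q * bracket m

  q^≈1-[1-q]bracket : ∀ m → q ^ m ≈ 1# - (1# - q) * bracket m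
  q^≈1-[1-q]bracket zero = solve 1 (λ q → con (1 , 0)
    := con (1 , 0) :- (con (1 , 0) :- q) :* con (0 , 0)) refl q
  q^≈1-[1-q]bracket (suc m) = trans (*-congˡ (q^≈1-[1-q]bracket m))
    (solve 2 (λ q b → q :* (con (1 , 0) :- (con (1 , 0) :- q) :* b)
      := con (1 , 0) :- (con (1 , 0) :- q) :* (con (1 , 0) :+ q :* b)) refl q (bracket m))

-- ι m stands for 1/[m + 1].
record QRing : Set₁ where
  field
    R : CommutativeRing 0ℓ 0ℓ
  open CommutativeRing R hiding (zero) public
  field
    q : Carrier
    ι : ℕ → Carrier
  open Bracket R q public
  field
    bracket-ι : ∀ m → bracket (suc m) * ι m ≈ 1#
    q-cancel : ∀ x → q * x ≈ 0# → x ≈ 0#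
    ⟦_⟧ : Poly → Carrier
    ⟦⟧-polyMul : ∀ c d → ⟦ polyMul c d ⟧ ≈ ⟦ c ⟧ * ⟦ d ⟧
    ⟦⟧-pOne : ⟦ pOne ⟧ ≈ 1#
    ⟦⟧-pMinusOne : ⟦ pMinusOne ⟧ ≈ - 1#
    ⟦⟧-pHbar : ⟦ pHbar ⟧ ≈ 1# - q

-- The Newton basis at negated q-integers and its two transforms

-- For j ≥ 1, a j N is the value at x = -[N] of x qʲ/[j] ∏_{0<l<j} (1 + x/[l]).
module NewtonBasis (Q : QRing) where
  open QRing Q
  open Solver R
  open Sums R
  open SetoidReasoning setoid
  open SemiringExp semiring using (_^_)

  a : ℕ → ℕ → Carrier
  a zero N = 1#
  a (suc j) zero = 0#
  a (suc j) (suc N) = q ^ suc j * (a (suc j) N - a j N)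

  -- In closed form `a j N` is (-1)^j q^(j(j+1)/2) times the Gaussian binomial coefficient of N over
  -- j, and its defining recurrence is one q-Pascal rule.
  a-above : ∀ {j N} → N < j → a j N ≈ 0#
  a-above {suc j} {zero} _ = refl
  a-above {suc j} {suc N} (s≤s N<j) = trans
    (*-congˡ (+-cong (a-above (ℕₚ.m<n⇒m<1+n N<j)) (-‿cong (a-above N<j))))
    (solve 1 (λ t → t :* (con (0 , 0) :- con (0 , 0)) := con (0 , 0)) refl _)

  mutual
    -- The quotient of neighbouring Gaussian binomials is [N-j]/[j+1]. Writing -q^j [N-j] as [j] -
    -- [N] avoids truncated subtraction and remains correct for j > N.
    a-ratio : ∀ j N → bracket (suc j) * a (suc j) N ≈ q * (bracket j - bracket N) * a j N
    a-ratio zero zero =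
      solve 1 (λ q → (con (1 , 0) :+ q :* con (0 , 0)) :* con (0 , 0)
        := q :* (con (0 , 0) :- con (0 , 0)) :* con (1 , 0)) refl q
    a-ratio (suc j) zero =
      solve 2 (λ q b → (con (1 , 0) :+ q :* b) :* con (0 , 0)
        := q :* (b :- con (0 , 0)) :* con (0 , 0)) refl q (bracket (suc j))
    a-ratio zero (suc N) = trans (a-diagonal-ratio zero N)
      (solve 2 (λ q b → :- (q :* con (1 , 0) :* b :* con (1 , 0))
        := q :* (con (0 , 0) :- b) :* con (1 , 0)) refl q (bracket (suc N)))
    a-ratio (suc j) (suc N) = begin
      bracket (suc (suc j)) * a (suc (suc j)) (suc N)
        ≈⟨ a-diagonal-ratio (suc j) N ⟩
      - (q * t * (1# + q * bN) * a′)
        ≈⟨ solve 5 (λ q t bj bN x → :- (q :* t :* (con (1 , 0) :+ q :* bN) :* x)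
             := q :* t :* (q :* (bj :- bN) :* x :- (con (1 , 0) :+ q :* bj) :* x)) refl q t bj bN a′ ⟩
      q * t * (q * (bj - bN) * a′ - bracket (suc j) * a′)
        ≈⟨ *-congˡ (+-congˡ (-‿cong (a-ratio j N))) ⟩
      q * t * (q * (bj - bN) * a′ - q * (bj - bN) * a j N)
        ≈⟨ solve 6 (λ q t bj bN x y → q :* t :* (q :* (bj :- bN) :* x :- q :* (bj :- bN) :* y)
             := q :* ((con (1 , 0) :+ q :* bj) :- (con (1 , 0) :+ q :* bN)) :* (t :* (x :- y)))
             refl q t bj bN a′ (a j N) ⟩
      q * (bracket (suc j) - bracket (suc N)) * a (suc j) (suc N) ∎
      where
      t bj bN a′ : Carrier
      t = q ^ suc j
      bj = bracket j
      bN = bracket N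
      a′ = a (suc j) N

    -- The absorption rule: [j+1] times the binomial of N+1 over j+1 is [N+1] times that of N over
    -- j.
    a-diagonal-ratio : ∀ j N → bracket (suc j) * a (suc j) (suc N) ≈ - (q ^ suc j * bracket (suc N) * a j N)
    a-diagonal-ratio j N = begin
      bracket (suc j) * (t * (a (suc j) N - a j N))
        ≈⟨ solve 4 (λ b t x y → b :* (t :* (x :- y)) := t :* (b :* x :- b :* y)) refl _ t _ _ ⟩
      t * (bracket (suc j) * a (suc j) N - bracket (suc j) * a j N)
        ≈⟨ *-congˡ (+-congʳ (a-ratio j N)) ⟩
      t * (q * (bracket j - bracket N) * a j N - bracket (suc j) * a j N)
        ≈⟨ solve 5 (λ q t bj bN x → t :* (q :* (bj :- bN) :* x :- (con (1 , 0) :+ q :* bj) :* x)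
             := :- (t :* (con (1 , 0) :+ q :* bN) :* x)) refl q t (bracket j) (bracket N) (a j N) ⟩
      - (t * bracket (suc N) * a j N) ∎
      where
      t : Carrier
      t = q ^ suc j

  -- The other q-Pascal rule. Its multiplier depends on N alone, so it can be pulled out of a sum
  -- over j.
  a-pascal : ∀ j N → a (suc j) (suc N) ≈ a (suc j) N - q ^ suc N * a j N
  a-pascal j N = begin
    q ^ suc j * (x - y)
      ≈⟨ *-congʳ (q^≈1-[1-q]bracket (suc j)) ⟩
    (1# - (1# - q) * bracket (suc j)) * (x - y)
      ≈⟨ solve 4 (λ q b x y → (con (1 , 0) :- (con (1 , 0) :- q) :* b) :* (x :- y)
           := x :- y :- (con (1 , 0) :- q) :* (b :* x :- b :* y)) refl q (bracket (suc j)) x y ⟩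
    x - y - (1# - q) * (bracket (suc j) * x - bracket (suc j) * y)
      ≈⟨ +-congˡ (-‿cong (*-congˡ (+-congʳ (a-ratio j N)))) ⟩
    x - y - (1# - q) * (q * (bracket j - bracket N) * y - bracket (suc j) * y)
      ≈⟨ solve 5 (λ q bj bN x y →
           x :- y :- (con (1 , 0) :- q) :* (q :* (bj :- bN) :* y :- (con (1 , 0) :+ q :* bj) :* y)
           := x :- (con (1 , 0) :- (con (1 , 0) :- q) :* (con (1 , 0) :+ q :* bN)) :* y)
           refl q (bracket j) (bracket N) x y ⟩
    x - (1# - (1# - q) * bracket (suc N)) * y
      ≈⟨ +-congˡ (-‿cong (*-congʳ (q^≈1-[1-q]bracket (suc N)))) ⟨
    x - q ^ suc N * y ∎
    where
    x y : Carrier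
    x = a (suc j) N
    y = a j N

  bracket-cancel : ∀ m {x y} → bracket (suc m) * x ≈ y → x ≈ ι m * y
  bracket-cancel m {x} {y} e = begin
    x                          ≈⟨ *-identityˡ x ⟨
    1# * x                     ≈⟨ *-congʳ (bracket-ι m) ⟨
    bracket (suc m) * ι m * x  ≈⟨ solve 3 (λ b i x → b :* i :* x := i :* (b :* x)) refl _ _ _ ⟩
    ι m * (bracket (suc m) * x) ≈⟨ *-congˡ e ⟩
    ι m * y ∎

  -- Turns the factor 1/[j+1] into a difference in j, at the price of [N+1]; this is what makes sums
  -- telescope below.
  a-difference : ∀ j N → bracket (suc N) * (ι j * a j N) ≈ a j N - a (suc j) N
  a-difference j N = sym (trans (bracket-cancel j (begin
    bracket (suc j) * (x - y)
      ≈⟨ solve 3 (λ b x y → b :* (x :- y) := b :* x :- b :* y) refl _ x y ⟩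
    bracket (suc j) * x - bracket (suc j) * y
      ≈⟨ +-congˡ (-‿cong (a-ratio j N)) ⟩
    (1# + q * bracket j) * x - q * (bracket j - bracket N) * x
      ≈⟨ solve 4 (λ q bj bN x → (con (1 , 0) :+ q :* bj) :* x :- q :* (bj :- bN) :* x
           := (con (1 , 0) :+ q :* bN) :* x) refl q _ _ x ⟩
    bracket (suc N) * x ∎))
    (solve 3 (λ i b x → i :* (b :* x) := b :* (i :* x)) refl _ _ _))
    where
    x y : Carrier
    x = a j N
    y = a (suc j) N

  p : ℕ → Carrier
  p m = q ^ suc m * ι m

  -- `B s N` will be the value at -[N] of a generating polynomial. `E` is, up to the factor
  -- -q^(N+1), the difference of `B` in N, and it is `E` that obeys the duality.
  E : (ℕ → Carrier) → ℕ → Carrier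
  E s N = ∑ (suc N) (λ j → s j * a j N)

  B : (ℕ → Carrier) → ℕ → Carrier
  B s N = ∑ N (λ j → s j * a (suc j) N)

  E-cong : ∀ N {s t} → (∀ j → s j ≈ t j) → E s N ≈ E t N
  E-cong N s≈t = ∑-cong (suc N) (λ j → *-congʳ (s≈t j))

  -- Absorption trades q^(j+1)/[j+1] for -1/[N+1], which no longer depends on j, and moves both
  -- indices of `a` up by one.
  E-p : ∀ s N → E (λ j → p j * s j) N ≈ - ι N * B s (suc N)
  E-p s N = trans (∑-cong (suc N) term) (∑-*ˡ (suc N) (- ι N) _)
    where
    term : ∀ j → p j * s j * a j N ≈ - ι N * (s j * a (suc j) (suc N))
    term j = begin
      q ^ suc j * ι j * s j * a j N
        ≈⟨ *-identityˡ _ ⟨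
      1# * (q ^ suc j * ι j * s j * a j N)
        ≈⟨ *-congʳ (bracket-ι N) ⟨
      bracket (suc N) * ι N * (q ^ suc j * ι j * s j * a j N)
        ≈⟨ solve 6 (λ b i t k s x → b :* i :* (t :* k :* s :* x)
             := :- i :* (s :* (k :* :- (t :* b :* x)))) refl _ _ _ _ _ _ ⟩
      - ι N * (s j * (ι j * - (q ^ suc j * bracket (suc N) * a j N)))
        ≈⟨ *-congˡ (*-congˡ (bracket-cancel j (a-diagonal-ratio j N))) ⟨
      - ι N * (s j * a (suc j) (suc N)) ∎

  B-suc : ∀ s N → B s (suc N) ≈ B s N - q ^ suc N * E s N
  B-suc s N = begin
    ∑ (suc N) (λ j → s j * a (suc j) (suc N))
      ≈⟨ ∑-cong (suc N) (λ j → trans (*-congˡ (a-pascal j N))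
           (solve 4 (λ s x t y → s :* (x :- t :* y) := s :* x :+ :- t :* (s :* y)) refl _ _ _ _)) ⟩
    ∑ (suc N) (λ j → s j * a (suc j) N + - q ^ suc N * (s j * a j N))
      ≈⟨ trans (∑-+ (suc N) _ _) (+-congˡ (∑-*ˡ (suc N) (- q ^ suc N) _)) ⟩
    B s N + s N * a (suc N) N + - q ^ suc N * E s N
      ≈⟨ +-congʳ (+-congˡ (*-congˡ (a-above (ℕₚ.n<1+n N)))) ⟩
    B s N + s N * 0# + - q ^ suc N * E s N
      ≈⟨ solve 4 (λ b s t e → b :+ s :* con (0 , 0) :+ :- t :* e := b :- t :* e) refl _ _ _ _ ⟩
    B s N - q ^ suc N * E s N ∎

  -- `B-suc` iterated. Put into `E-p`, it gives half of the exchange: multiplication by p before the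
  -- transform becomes partial summation after it.
  B≈-∑E : ∀ s N → B s N ≈ - ∑ N (λ i → q ^ suc i * E s i)
  B≈-∑E s zero = solve 0 (con (0 , 0) := :- con (0 , 0)) refl
  B≈-∑E s (suc N) = trans (B-suc s N) (trans (+-congʳ (B≈-∑E s N))
    (solve 2 (λ x y → :- x :- y := :- (x :+ y)) refl _ _))

  -- By `a-difference` the sum telescopes from `a 0 N`, which is 1, to a term out of range. It
  -- starts the duality at the one-letter word 1.
  E-ι : ∀ N → E ι N ≈ ι N
  E-ι N = trans (bracket-cancel N (begin
    bracket (suc N) * E ι N
      ≈⟨ ∑-*ˡ (suc N) _ _ ⟨
    ∑ (suc N) (λ j → bracket (suc N) * (ι j * a j N))
      ≈⟨ ∑-cong (suc N) (λ j → a-difference j N) ⟩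
    ∑ (suc N) (λ j → a j N - a (suc j) N)
      ≈⟨ ∑-telescope (suc N) (λ j → a j N) ⟩
    1# - a (suc N) N
      ≈⟨ +-congˡ (-‿cong (a-above (ℕₚ.n<1+n N))) ⟩
    1# - 0#
      ≈⟨ solve 0 (con (1 , 0) :- con (0 , 0) := con (1 , 0)) refl ⟩
    1# ∎)) (*-identityʳ _)

  -- The other half of the exchange. After multiplication by [N+1], summation by parts on the strict
  -- partial sums leaves a sum T; the diagonal terms `p j * s j`, rewritten by `a-pascal`,
  -- contribute -T and q^(N+1) E s N.
  E-partial-sums : ∀ s N → E (λ j → ι j * ∑ j s + p j * s j) N ≈ p N * E s N
  E-partial-sums s N = trans (bracket-cancel N (begin
    bracket (suc N) * E (λ j → ι j * ∑ j s + p j * s j) N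
      ≈⟨ ∑-*ˡ (suc N) _ _ ⟨
    ∑ (suc N) (λ j → bracket (suc N) * ((ι j * ∑ j s + p j * s j) * a j N))
      ≈⟨ ∑-cong (suc N) term ⟩
    ∑ (suc N) (λ j → (a j N - a (suc j) N) * ∑ j s + (q ^ suc N * (s j * a j N) + - 1# * (s j * a (suc j) N)))
      ≈⟨ trans (∑-+ (suc N) _ _) (+-cong (∑-summation-by-parts (suc N) (λ j → a j N) s) (∑-+ (suc N) _ _)) ⟩
    T - a (suc N) N * ∑ (suc N) s +
        (∑ (suc N) (λ j → q ^ suc N * (s j * a j N)) + ∑ (suc N) (λ j → - 1# * (s j * a (suc j) N)))
      ≈⟨ +-cong (+-congˡ (-‿cong (*-congʳ (a-above (ℕₚ.n<1+n N))))) (+-cong (∑-*ˡ (suc N) _ _) (∑-*ˡ (suc N) _ _)) ⟩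
    T - 0# * ∑ (suc N) s + (q ^ suc N * E s N + - 1# * T)
      ≈⟨ solve 4 (λ T S t e → T :- con (0 , 0) :* S :+ (t :* e :+ :- con (1 , 0) :* T) := t :* e) refl _ _ _ _ ⟩
    q ^ suc N * E s N ∎))
    (solve 3 (λ i t e → i :* (t :* e) := t :* i :* e) refl _ _ _)
    where
    T : Carrier
    T = ∑ (suc N) (λ j → s j * a (suc j) N)

    term : ∀ j → bracket (suc N) * ((ι j * ∑ j s + p j * s j) * a j N) ≈
      (a j N - a (suc j) N) * ∑ j s + (q ^ suc N * (s j * a j N) + - 1# * (s j * a (suc j) N))
    term j = begin
      bracket (suc N) * ((ι j * S + t * ι j * s j) * x)
        ≈⟨ solve 6 (λ b i S t s x → b :* ((i :* S :+ t :* i :* s) :* x)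
             := b :* (i :* x) :* S :+ b :* (i :* x) :* t :* s) refl _ _ S t (s j) x ⟩
      bracket (suc N) * (ι j * x) * S + bracket (suc N) * (ι j * x) * t * s j
        ≈⟨ +-cong (*-congʳ (a-difference j N)) (*-congʳ (*-congʳ (a-difference j N))) ⟩
      (x - y) * S + (x - y) * t * s j
        ≈⟨ solve 5 (λ x y t s D → D :+ (x :- y) :* t :* s := D :+ :- (t :* (y :- x)) :* s) refl x y t (s j) _ ⟩
      (x - y) * S + - (t * (y - x)) * s j
        ≈⟨ +-congˡ (*-congʳ (-‿cong (a-pascal j N))) ⟩
      (x - y) * S + - (y - q ^ suc N * x) * s j
        ≈⟨ solve 5 (λ x y u s D → D :+ :- (y :- u :* x) :* s
             := D :+ (u :* (s :* x) :+ :- con (1 , 0) :* (s :* y))) refl x y (q ^ suc N) (s j) _ ⟩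
      (x - y) * S + (q ^ suc N * (s j * x) + - 1# * (s j * y)) ∎
      where
      S t x y : Carrier
      S = ∑ j s
      t = q ^ suc j
      x = a j N
      y = a (suc j) N

-- Compositions and the map φ on words

Positive : Word → Set
Positive w = NonEmpty w × ValidWord w

-- A positive word grows from the word 1 by opening a new block or enlarging the first one. Taking
-- complements of partial sums, φ interchanges the two moves, so this is the induction principle for
-- everything about φ.
data Composition : Word → Set where
  unit : Composition (1 ∷ [])
  extend : ∀ {k w} → Composition (k ∷ w) → Composition (1 ∷ k ∷ w)
  raise : ∀ {k w} → Composition (suc k ∷ w) → Composition (suc (suc k) ∷ w)

composition : ∀ w → Positive w → Composition w
composition (suc zero ∷ []) _ = unit
composition (suc zero ∷ k ∷ w) (_ , _ ∷ valid) = extend (composition (k ∷ w) (tt , valid))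
composition (suc (suc k) ∷ w) (_ , _ ∷ valid) = raise (composition (suc k ∷ w) (tt , s≤s z≤n ∷ valid))
composition (zero ∷ w) (_ , () ∷ _)

remove : List ℕ → List ℕ → List ℕ
remove L = filter (λ x → ¬? (x ∈? L))

remove-∈ : ∀ L {x xs} → x ∈ L → remove L (x ∷ xs) ≡ remove L xs
remove-∈ L x∈L = filter-reject (λ x → ¬? (x ∈? L)) (λ x∉L → x∉L x∈L)

remove-∉ : ∀ L {x xs} → x ∉ L → remove L (x ∷ xs) ≡ x ∷ remove L xs
remove-∉ L = filter-accept (λ x → ¬? (x ∈? L))

suc∈map-suc⁻ : ∀ {x L} → suc x ∈ map suc L → x ∈ L
suc∈map-suc⁻ i with ∈-map⁻ suc i
... | _ , x∈L , ≡.refl = x∈L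

zero∉map-suc : ∀ {L} → 0 ∉ map suc L
zero∉map-suc i with ∈-map⁻ suc i
... | _ , _ , ()

remove-map-suc : ∀ L xs → remove (map suc L) (map suc xs) ≡ map suc (remove L xs)
remove-map-suc L [] = ≡.refl
remove-map-suc L (x ∷ xs) with x ∈? L
... | yes x∈L = ≡.trans (remove-∈ (map suc L) (∈-map⁺ suc x∈L)) (remove-map-suc L xs)
... | no x∉L = ≡.trans (remove-∉ (map suc L) (x∉L ∘ suc∈map-suc⁻)) (≡.cong (suc x ∷_) (remove-map-suc L xs))

remove-zero-map-suc : ∀ L xs → remove (0 ∷ L) (map suc xs) ≡ remove L (map suc xs)
remove-zero-map-suc L [] = ≡.refl
remove-zero-map-suc L (x ∷ xs) with suc x ∈? L
... | yes _ = remove-zero-map-suc L xs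
... | no _ = ≡.cong (suc x ∷_) (remove-zero-map-suc L xs)

partialSums-suc : ∀ n w → partialSums (suc n) w ≡ map suc (partialSums n w)
partialSums-suc n [] = ≡.refl
partialSums-suc n (k ∷ []) = ≡.refl
partialSums-suc n (k ∷ l ∷ w) = ≡.cong (suc (n ℕ.+ k) ∷_) (partialSums-suc (n ℕ.+ k) (l ∷ w))

partialSums-raise : ∀ k w → partialSums 0 (suc k ∷ w) ≡ map suc (partialSums 0 (k ∷ w))
partialSums-raise k [] = ≡.refl
partialSums-raise k (l ∷ w) = ≡.cong (suc k ∷_) (partialSums-suc k (l ∷ w))

bump : Word → Word
bump [] = []
bump (k ∷ w) = suc k ∷ w

diffs-map-suc : ∀ n xs → diffs (suc n) (map suc xs) ≡ diffs n xs
diffs-map-suc n [] = ≡.refl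
diffs-map-suc n (x ∷ xs) = ≡.cong (x ℕ.∸ n ∷_) (diffs-map-suc x xs)

diffs-zero-map-suc : ∀ xs → diffs 0 (map suc xs) ≡ bump (diffs 0 xs)
diffs-zero-map-suc [] = ≡.refl
diffs-zero-map-suc (x ∷ xs) = ≡.cong (suc x ∷_) (diffs-map-suc x xs)

positions : ℕ → List ℕ
positions n = map suc (upTo n)

positions-suc : ∀ n → positions (suc n) ≡ map suc (0 ∷ positions n)
positions-suc n = ≡.cong (λ xs → map suc (0 ∷ xs)) (≡.sym (map-upTo suc n))

-- Prepending 1 shifts all partial sums by one and adds the position 1. The complement is therefore
-- only shifted, and its first gap grows by one.
phiW-extend : ∀ k w → phiW (1 ∷ k ∷ w) ≡ bump (phiW (k ∷ w))
phiW-extend k w = begin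
  diffs 0 (remove (1 ∷ partialSums 1 (k ∷ w)) (positions (suc K)))
    ≡⟨ ≡.cong₂ (λ L xs → diffs 0 (remove (1 ∷ L) xs)) (partialSums-suc 0 (k ∷ w)) (positions-suc K) ⟩
  diffs 0 (remove (map suc (0 ∷ L)) (map suc (0 ∷ positions K)))
    ≡⟨ ≡.cong (diffs 0) (remove-map-suc (0 ∷ L) (0 ∷ positions K)) ⟩
  diffs 0 (map suc (remove (0 ∷ L) (positions K)))
    ≡⟨ ≡.cong (diffs 0 ∘ map suc) (remove-zero-map-suc L (upTo K)) ⟩
  diffs 0 (map suc (remove L (positions K)))
    ≡⟨ diffs-zero-map-suc (remove L (positions K)) ⟩
  bump (diffs 0 (remove L (positions K))) ∎
  where
  open ≡.≡-Reasoning
  K : ℕ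
  K = weight (k ∷ w)
  L : List ℕ
  L = partialSums 0 (k ∷ w)

-- Here the partial sums are shifted and nothing is added, so position 1 stays in the complement and
-- opens a gap of its own.
phiW-raise : ∀ k w → phiW (suc (suc k) ∷ w) ≡ 1 ∷ phiW (suc k ∷ w)
phiW-raise k w = begin
  diffs 0 (remove (partialSums 0 (suc (suc k) ∷ w)) (positions (suc K)))
    ≡⟨ ≡.cong₂ (λ L xs → diffs 0 (remove L xs)) (partialSums-raise (suc k) w) (positions-suc K) ⟩
  diffs 0 (remove (map suc L) (map suc (0 ∷ positions K)))
    ≡⟨ ≡.cong (diffs 0) (remove-map-suc L (0 ∷ positions K)) ⟩
  diffs 0 (map suc (remove L (0 ∷ positions K)))
    ≡⟨ ≡.cong (diffs 0 ∘ map suc) (remove-∉ L 0∉L) ⟩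
  1 ∷ diffs 1 (map suc (remove L (positions K)))
    ≡⟨ ≡.cong (1 ∷_) (diffs-map-suc 0 (remove L (positions K))) ⟩
  1 ∷ diffs 0 (remove L (positions K)) ∎
  where
  open ≡.≡-Reasoning
  K : ℕ
  K = weight (suc k ∷ w)
  L : List ℕ
  L = partialSums 0 (suc k ∷ w)
  0∉L : 0 ∉ L
  0∉L = zero∉map-suc ∘ ≡.subst (0 ∈_) (partialSums-raise k w)

bump-positive : ∀ w → Positive w → Positive (bump w)
bump-positive (k ∷ w) (_ , _ ∷ valid) = tt , s≤s z≤n ∷ valid

phiW-positive : ∀ {w} → Composition w → Positive (phiW w)
phiW-positive unit = tt , s≤s z≤n ∷ []
phiW-positive (extend {k} {w} c) =
  ≡.subst Positive (≡.sym (phiW-extend k w)) (bump-positive (phiW (k ∷ w)) (phiW-positive c))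
phiW-positive (raise {k} {w} c) =
  ≡.subst Positive (≡.sym (phiW-raise k w)) (tt , s≤s z≤n ∷ proj₂ (phiW-positive c))

-- Positivity of the words produced by the products, by d and by φ

AllWords : (Word → Set) → H → Set
AllWords P = All (P ∘ proj₂)

module _ {P : Word → Set} where

  allWords-scaleH : ∀ c h → AllWords P h → AllWords P (scaleH c h)
  allWords-scaleH c [] [] = []
  allWords-scaleH c (_ ∷ h) (x ∷ xs) = x ∷ allWords-scaleH c h xs

  allWords-prefixH : ∀ {S : Word → Set} k h → (∀ w → S w → P (k ∷ w)) → AllWords S h → AllWords P (prefixH k h)
  allWords-prefixH k [] f [] = []
  allWords-prefixH k ((_ , w) ∷ h) f (x ∷ xs) = f w x ∷ allWords-prefixH k h f xs

  allWords-lin : ∀ {S : Word → Set} {f} h → (∀ w → S w → AllWords P (f w)) → AllWords S h → AllWords P (lin f h)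
  allWords-lin [] f [] = []
  allWords-lin ((c , w) ∷ h) f (x ∷ xs) = ++⁺ (allWords-scaleH c _ (f w x)) (allWords-lin h f xs)

  allWords-bilin : ∀ {S T : Word → Set} {f} g h → (∀ u v → S u → T v → AllWords P (f u v)) →
    AllWords S g → AllWords T h → AllWords P (bilin f g h)
  allWords-bilin [] h f [] ys = []
  allWords-bilin {S} {T} {F} ((c , u) ∷ g) h f (x ∷ xs) ys = ++⁺ (row h ys) (allWords-bilin g h f xs ys)
    where
    row : ∀ h → AllWords T h → AllWords P
      (concatMap (λ t → scaleH (polyMul c (proj₁ t)) (F u (proj₂ t))) h)
    row [] [] = []
    row ((e , v) ∷ h) (y ∷ ys) = ++⁺ (allWords-scaleH (polyMul c e) _ (f u v x y)) (row h ys)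

prefixH-positive : ∀ {k} h → 1 ≤ k → AllWords ValidWord h → AllWords Positive (prefixH k h)
prefixH-positive {k} h 1≤k = allWords-prefixH k h (λ w valid → tt , 1≤k ∷ valid)

-- The product recurses into tails that may be empty, so this version for all words is proved
-- together with the one for nonempty words.
starBarW-valid : ∀ u v → ValidWord u → ValidWord v → AllWords ValidWord (starBarW u v)
starBarW-positive : ∀ u v → Positive u → Positive v → AllWords Positive (starBarW u v)

starBarW-valid [] v valid-u valid-v = valid-v ∷ []
starBarW-valid (i ∷ u) [] valid-u valid-v = valid-u ∷ []
starBarW-valid (i ∷ u) (j ∷ v) valid-u valid-v =
  All.map proj₂ (starBarW-positive (i ∷ u) (j ∷ v) (tt , valid-u) (tt , valid-v))

starBarW-positive (i ∷ u) (j ∷ v) (_ , 1≤i ∷ valid-u) (_ , 1≤j ∷ valid-v) =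
  ++⁺ (prefixH-positive _ 1≤i (starBarW-valid u (j ∷ v) valid-u (1≤j ∷ valid-v)))
    (++⁺ (prefixH-positive _ 1≤j (starBarW-valid (i ∷ u) v (1≤i ∷ valid-u) valid-v))
      (allWords-scaleH pMinusOne _
        (prefixH-positive _ (ℕₚ.≤-trans 1≤i (ℕₚ.m≤m+n i j)) (starBarW-valid u v valid-u valid-v))))

circH-positive : ∀ i h → 1 ≤ i → AllWords ValidWord h → AllWords Positive (circH i h)
circH-positive i h 1≤i = allWords-lin h on-words
  where
  on-words : ∀ w → ValidWord w → AllWords Positive (circW i w)
  on-words [] _ = []
  on-words (j ∷ w) (_ ∷ valid) = (tt , ℕₚ.≤-trans 1≤i (ℕₚ.m≤m+n i j) ∷ valid) ∷ []

dW-valid : ∀ w → ValidWord w → AllWords ValidWord (dW w)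
dW-positive : ∀ w → Positive w → AllWords Positive (dW w)

dW-valid [] _ = [] ∷ []
dW-valid (i ∷ w) valid = All.map proj₂ (dW-positive (i ∷ w) (tt , valid))

dW-positive (i ∷ w) (_ , 1≤i ∷ valid) =
  ++⁺ (prefixH-positive _ 1≤i (dW-valid w valid)) (circH-positive i _ 1≤i (dW-valid w valid))

dφ-positive : ∀ h → InH1pos h → InH1pos (d (phi h))
dφ-positive h pos = allWords-lin (phi h) dW-positive
  (allWords-lin h (λ w pos-w → phiW-positive (composition w pos-w) ∷ []) pos)

starBar-positive : ∀ g h → InH1pos g → InH1pos h → InH1pos (starBar g h)
starBar-positive g h = allWords-bilin g h starBarW-positive

replicate-valid : ∀ n → ValidWord (replicate n 1)
replicate-valid zero = []
replicate-valid (suc n) = s≤s z≤n ∷ replicate-valid n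

-- Linear extension of functions on words

module LinearExtension (Q : QRing) where
  open QRing Q
  open Solver R
  open Sums R
  open SetoidReasoning setoid

  -- Elements of `H` are formal lists, not classes of lists; they are compared only through their
  -- images under such maps.
  ext : (Word → Carrier) → H → Carrier
  ext g [] = 0#
  ext g ((c , w) ∷ h) = ⟦ c ⟧ * g w + ext g h

  ext-cong : ∀ {g g′} {P : Word → Set} h → AllWords P h → (∀ w → P w → g w ≈ g′ w) → ext g h ≈ ext g′ h
  ext-cong [] [] g≈g′ = refl
  ext-cong ((c , w) ∷ h) (x ∷ xs) g≈g′ = +-cong (*-congˡ (g≈g′ w x)) (ext-cong h xs g≈g′)

  ext-cong-everywhere : ∀ {g g′} h → (∀ w → g w ≈ g′ w) → ext g h ≈ ext g′ h
  ext-cong-everywhere [] g≈g′ = refl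
  ext-cong-everywhere ((c , w) ∷ h) g≈g′ = +-cong (*-congˡ (g≈g′ w)) (ext-cong-everywhere h g≈g′)

  ext-++ : ∀ g h k → ext g (h ++ k) ≈ ext g h + ext g k
  ext-++ g [] k = sym (+-identityˡ _)
  ext-++ g ((c , w) ∷ h) k = trans (+-congˡ (ext-++ g h k)) (sym (+-assoc _ _ _))

  ext-scaleH : ∀ g c h → ext g (scaleH c h) ≈ ⟦ c ⟧ * ext g h
  ext-scaleH g c [] = sym (zeroʳ _)
  ext-scaleH g c ((e , w) ∷ h) = trans (+-cong (*-congʳ (⟦⟧-polyMul c e)) (ext-scaleH g c h))
    (solve 4 (λ c e x y → c :* e :* x :+ c :* y := c :* (e :* x :+ y)) refl _ _ _ _)

  ext-prefixH : ∀ g k h → ext g (prefixH k h) ≈ ext (g ∘ (k ∷_)) h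
  ext-prefixH g k [] = refl
  ext-prefixH g k (_ ∷ h) = +-congˡ (ext-prefixH g k h)

  ext-wordH : ∀ g w → ext g (wordH w) ≈ g w
  ext-wordH g w = trans (+-identityʳ _) (trans (*-congʳ ⟦⟧-pOne) (*-identityˡ _))

  ext-lin : ∀ g f h → ext g (lin f h) ≈ ext (ext g ∘ f) h
  ext-lin g f [] = refl
  ext-lin g f ((c , w) ∷ h) = trans (ext-++ g (scaleH c (f w)) _) (+-cong (ext-scaleH g c (f w)) (ext-lin g f h))

  ext-*ˡ : ∀ c g h → ext (λ w → c * g w) h ≈ c * ext g h
  ext-*ˡ c g [] = sym (zeroʳ c)
  ext-*ˡ c g ((e , w) ∷ h) = trans (+-congˡ (ext-*ˡ c g h))
    (solve 4 (λ c e x y → e :* (c :* x) :+ c :* y := c :* (e :* x :+ y)) refl _ _ _ _)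

  ext-*ʳ : ∀ c g h → ext (λ w → g w * c) h ≈ ext g h * c
  ext-*ʳ c g h = trans (ext-cong-everywhere h (λ w → *-comm _ c)) (trans (ext-*ˡ c g h) (*-comm c _))

  ext-+ : ∀ g g′ h → ext (λ w → g w + g′ w) h ≈ ext g h + ext g′ h
  ext-+ g g′ [] = sym (+-identityʳ 0#)
  ext-+ g g′ ((e , w) ∷ h) = trans (+-congˡ (ext-+ g g′ h))
    (solve 5 (λ e x y X Y → e :* (x :+ y) :+ (X :+ Y) := e :* x :+ X :+ (e :* y :+ Y)) refl _ _ _ _ _)

  ext-zero : ∀ h → ext (λ _ → 0#) h ≈ 0#
  ext-zero [] = refl
  ext-zero (_ ∷ h) = trans (+-cong (zeroʳ _) (ext-zero h)) (+-identityʳ 0#)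

  ext-∑ : ∀ n (g : ℕ → Word → Carrier) h → ext (λ w → ∑ n (λ m → g m w)) h ≈ ∑ n (λ m → ext (g m) h)
  ext-∑ zero g h = ext-zero h
  ext-∑ (suc n) g h = trans (ext-+ _ (g n) h) (+-congʳ (ext-∑ n g h))

  ext-bilin : ∀ g f x y → ext g (bilin f x y) ≈ ext (λ u → ext (λ v → ext g (f u v)) y) x
  ext-bilin g f [] y = refl
  ext-bilin g f ((c , u) ∷ x) y = trans (ext-++ g (row y) _) (+-cong (ext-row y) (ext-bilin g f x y))
    where
    row : H → H
    row = concatMap (λ t → scaleH (polyMul c (proj₁ t)) (f u (proj₂ t)))

    ext-row : ∀ y → ext g (row y) ≈ ⟦ c ⟧ * ext (λ v → ext g (f u v)) y
    ext-row [] = sym (zeroʳ _)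
    ext-row ((e , v) ∷ y) = trans (ext-++ g (scaleH (polyMul c e) (f u v)) (row y))
      (trans (+-cong (trans (ext-scaleH g (polyMul c e) (f u v)) (*-congʳ (⟦⟧-polyMul c e))) (ext-row y))
        (solve 4 (λ c e x y → c :* e :* x :+ c :* y := c :* (e :* x :+ y)) refl _ _ _ _))

  ext-multiplicative : ∀ g f → (∀ u v → ext g (f u v) ≈ g u * g v) →
    ∀ x y → ext g (bilin f x y) ≈ ext g x * ext g y
  ext-multiplicative g f mult x y = begin
    ext g (bilin f x y)                          ≈⟨ ext-bilin g f x y ⟩
    ext (λ u → ext (λ v → ext g (f u v)) y) x    ≈⟨ ext-cong-everywhere x (λ u → ext-cong-everywhere y (mult u)) ⟩
    ext (λ u → ext (λ v → g u * g v) y) x        ≈⟨ ext-cong-everywhere x (λ u → ext-*ˡ (g u) g y) ⟩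
    ext (λ u → g u * ext g y) x                  ≈⟨ ext-*ʳ (ext g y) g x ⟩
    ext g x * ext g y                            ∎

-- Truncated nested sums and their product formulas

module HarmonicSums (Q : QRing) where
  open QRing Q
  open Solver R
  open Sums R
  open LinearExtension Q
  open NewtonBasis Q
  open SetoidReasoning setoid
  open SemiringExp semiring using (_^_; ^-homo-*)

  -- q^((k-1)(m+1))/[m+1]ᵏ for k ≥ 1
  letter : ℕ → ℕ → Carrier
  letter zero m = 1#
  letter (suc k) m = p m ^ k * ι m

  Z : Word → ℕ → Carrier
  Z [] b = 1#
  Z (k ∷ w) zero = 0#
  Z (k ∷ w) (suc b) = Z (k ∷ w) b + letter k b * Z w b

  -- The terms of `Z` whose largest index is exactly m + 1; the empty word has no largest index and
  -- gets zero.
  Top : Word → ℕ → Carrier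
  Top [] m = 0#
  Top (k ∷ w) m = letter k m * Z w m

  Z≈∑Top : ∀ w → NonEmpty w → ∀ b → Z w b ≈ ∑ b (Top w)
  Z≈∑Top (k ∷ w) _ zero = refl
  Z≈∑Top (k ∷ w) _ (suc b) = +-congʳ (Z≈∑Top (k ∷ w) tt b)

  -- From 1 - q^m = (1 - q)[m]. This identity is the origin of the ħ-term in `starPlusW`.
  ι≈p+1-q : ∀ m → ι m ≈ p m + (1# - q)
  ι≈p+1-q m = sym (begin
    q ^ suc m * ι m + (1# - q)
      ≈⟨ +-congʳ (*-congʳ (q^≈1-[1-q]bracket (suc m))) ⟩
    (1# - (1# - q) * bracket (suc m)) * ι m + (1# - q)
      ≈⟨ solve 3 (λ i b q → (con (1 , 0) :- (con (1 , 0) :- q) :* b) :* i :+ (con (1 , 0) :- q)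
           := i :+ (con (1 , 0) :- q) :* (con (1 , 0) :- b :* i)) refl (ι m) (bracket (suc m)) q ⟩
    ι m + (1# - q) * (1# - bracket (suc m) * ι m)
      ≈⟨ +-congˡ (*-congˡ (+-congˡ (-‿cong (bracket-ι m)))) ⟩
    ι m + (1# - q) * (1# - 1#)
      ≈⟨ solve 2 (λ i q → i :+ (con (1 , 0) :- q) :* (con (1 , 0) :- con (1 , 0)) := i) refl (ι m) q ⟩
    ι m ∎)

  letter-product : ∀ {i j} m → 1 ≤ i → 1 ≤ j →
    letter i m * letter j m ≈ letter (i ℕ.+ j) m + (1# - q) * letter (i ℕ.+ j ∸ 1) m
  letter-product {suc i} {suc j} m _ _ rewrite ℕₚ.+-suc i j = begin
    p m ^ i * ι m * (p m ^ j * ι m)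
      ≈⟨ *-congʳ (*-congˡ (ι≈p+1-q m)) ⟩
    p m ^ i * (p m + (1# - q)) * (p m ^ j * ι m)
      ≈⟨ solve 5 (λ x y P i q → x :* (P :+ (con (1 , 0) :- q)) :* (y :* i)
           := P :* (x :* y) :* i :+ (con (1 , 0) :- q) :* (x :* y :* i)) refl _ _ (p m) (ι m) q ⟩
    p m * (p m ^ i * p m ^ j) * ι m + (1# - q) * (p m ^ i * p m ^ j * ι m)
      ≈⟨ +-cong (*-congʳ (*-congˡ (^-homo-* (p m) i j))) (*-congˡ (*-congʳ (^-homo-* (p m) i j))) ⟨
    p m * p m ^ (i ℕ.+ j) * ι m + (1# - q) * (p m ^ (i ℕ.+ j) * ι m) ∎

  ext-Z-zero : ∀ k h → ext (λ w → Z w 0) (prefixH k h) ≈ 0#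
  ext-Z-zero k h = trans (ext-prefixH _ k h) (ext-zero h)

  ext-Z-suc : ∀ b k h → ext (λ w → Z w (suc b)) (prefixH k h) ≈
    ext (λ w → Z w b) (prefixH k h) + letter k b * ext (λ w → Z w b) h
  ext-Z-suc b k h = begin
    ext (λ w → Z w (suc b)) (prefixH k h)
      ≈⟨ ext-prefixH _ k h ⟩
    ext (λ w → Z (k ∷ w) b + letter k b * Z w b) h
      ≈⟨ ext-+ _ _ h ⟩
    ext (λ w → Z (k ∷ w) b) h + ext (λ w → letter k b * Z w b) h
      ≈⟨ +-cong (ext-prefixH _ k h) (sym (ext-*ˡ (letter k b) _ h)) ⟨
    ext (λ w → Z w b) (prefixH k h) + letter k b * ext (λ w → Z w b) h ∎

  ext-Z-prefixH : ∀ b k h → ext (λ w → Z w b) (prefixH k h) ≈ ∑ b (λ m → letter k m * ext (λ w → Z w m) h)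
  ext-Z-prefixH zero k h = ext-Z-zero k h
  ext-Z-prefixH (suc b) k h = trans (ext-Z-suc b k h) (+-congʳ (ext-Z-prefixH b k h))

  ext-starPlusW : ∀ g i u j v → ext g (starPlusW (i ∷ u) (j ∷ v)) ≈
    ext g (prefixH i (starPlusW u (j ∷ v))) + (ext g (prefixH j (starPlusW (i ∷ u) v)) +
    (ext g (prefixH (i ℕ.+ j) (starPlusW u v)) + (1# - q) * ext g (prefixH (i ℕ.+ j ∸ 1) (starPlusW u v))))
  ext-starPlusW g i u j v =
    trans (ext-++ g (prefixH i (starPlusW u (j ∷ v))) _) (+-congˡ
    (trans (ext-++ g (prefixH j (starPlusW (i ∷ u) v)) _) (+-congˡ
    (trans (ext-++ g (prefixH (i ℕ.+ j) (starPlusW u v)) _) (+-congˡ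
    (trans (ext-scaleH g pHbar (prefixH (i ℕ.+ j ∸ 1) (starPlusW u v))) (*-congʳ ⟦⟧-pHbar)))))))

  -- Quasi-shuffle: in a product of two nested sums the largest indices differ or coincide, and in
  -- the second case `letter-product` splits the product of the two letters into the last two terms
  -- of `starPlusW`.
  Z-starPlusW : ∀ u v → ValidWord u → ValidWord v → ∀ b → ext (λ w → Z w b) (starPlusW u v) ≈ Z u b * Z v b
  Z-starPlusW [] v _ _ b = trans (ext-wordH (λ w → Z w b) v) (sym (*-identityˡ _))
  Z-starPlusW (i ∷ u) [] _ _ b = trans (ext-wordH (λ w → Z w b) (i ∷ u)) (sym (*-identityʳ _))
  Z-starPlusW (i ∷ u) (j ∷ v) (1≤i ∷ valid-u) (1≤j ∷ valid-v) = by-bound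
    where
    U V UV : H
    U = starPlusW u (j ∷ v)
    V = starPlusW (i ∷ u) v
    UV = starPlusW u v

    by-bound : ∀ b → ext (λ w → Z w b) (starPlusW (i ∷ u) (j ∷ v)) ≈ Z (i ∷ u) b * Z (j ∷ v) b
    by-bound zero = trans (ext-starPlusW _ i u j v) (trans
      (+-cong (ext-Z-zero i U) (+-cong (ext-Z-zero j V)
        (+-cong (ext-Z-zero (i ℕ.+ j) UV) (*-congˡ (ext-Z-zero (i ℕ.+ j ∸ 1) UV)))))
      (solve 1 (λ h → con (0 , 0) :+ (con (0 , 0) :+ (con (0 , 0) :+ h :* con (0 , 0)))
        := con (0 , 0) :* con (0 , 0)) refl (1# - q)))
    by-bound (suc b) = begin
      ext (λ w → Z w (suc b)) (starPlusW (i ∷ u) (j ∷ v))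
        ≈⟨ ext-starPlusW _ i u j v ⟩
      ext (λ w → Z w (suc b)) (prefixH i U) + (ext (λ w → Z w (suc b)) (prefixH j V) +
        (ext (λ w → Z w (suc b)) (prefixH (i ℕ.+ j) UV) +
          (1# - q) * ext (λ w → Z w (suc b)) (prefixH (i ℕ.+ j ∸ 1) UV)))
        ≈⟨ +-cong (ext-Z-suc b i U) (+-cong (ext-Z-suc b j V)
             (+-cong (ext-Z-suc b (i ℕ.+ j) UV) (*-congˡ (ext-Z-suc b (i ℕ.+ j ∸ 1) UV)))) ⟩
      X₁ + letter i b * Y₁ + (X₂ + letter j b * Y₂ +
        (X₃ + letter (i ℕ.+ j) b * Y₃ + (1# - q) * (X₄ + letter (i ℕ.+ j ∸ 1) b * Y₃)))
        ≈⟨ solve 12 (λ X₁ X₂ X₃ X₄ Y₁ Y₂ Y₃ a b c e h →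
             X₁ :+ a :* Y₁ :+ (X₂ :+ b :* Y₂ :+ (X₃ :+ c :* Y₃ :+ h :* (X₄ :+ e :* Y₃)))
             := X₁ :+ (X₂ :+ (X₃ :+ h :* X₄)) :+ a :* Y₁ :+ b :* Y₂ :+ (c :+ h :* e) :* Y₃)
             refl X₁ X₂ X₃ X₄ Y₁ Y₂ Y₃ _ _ _ _ (1# - q) ⟩
      X₁ + (X₂ + (X₃ + (1# - q) * X₄)) + letter i b * Y₁ + letter j b * Y₂
        + (letter (i ℕ.+ j) b + (1# - q) * letter (i ℕ.+ j ∸ 1) b) * Y₃
        ≈⟨ +-cong (+-cong (+-cong
             (trans (sym (ext-starPlusW _ i u j v)) (by-bound b))
             (*-congˡ (Z-starPlusW u (j ∷ v) valid-u (1≤j ∷ valid-v) b)))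
             (*-congˡ (Z-starPlusW (i ∷ u) v (1≤i ∷ valid-u) valid-v b)))
             (*-cong (sym (letter-product b 1≤i 1≤j)) (Z-starPlusW u v valid-u valid-v b)) ⟩
      Z (i ∷ u) b * Z (j ∷ v) b + letter i b * (Z u b * Z (j ∷ v) b) + letter j b * (Z (i ∷ u) b * Z v b)
        + letter i b * letter j b * (Z u b * Z v b)
        ≈⟨ solve 6 (λ A B x y s t → A :* B :+ s :* (x :* B) :+ t :* (A :* y) :+ s :* t :* (x :* y)
             := (A :+ s :* x) :* (B :+ t :* y)) refl _ _ (Z u b) (Z v b) _ _ ⟩
      Z (i ∷ u) (suc b) * Z (j ∷ v) (suc b) ∎
      where
      X₁ X₂ X₃ X₄ Y₁ Y₂ Y₃ : Carrier
      X₁ = ext (λ w → Z w b) (prefixH i U)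
      X₂ = ext (λ w → Z w b) (prefixH j V)
      X₃ = ext (λ w → Z w b) (prefixH (i ℕ.+ j) UV)
      X₄ = ext (λ w → Z w b) (prefixH (i ℕ.+ j ∸ 1) UV)
      Y₁ = ext (λ w → Z w b) U
      Y₂ = ext (λ w → Z w b) V
      Y₃ = ext (λ w → Z w b) UV

  -- The product forces both words to share their largest index. Adding 1 to a positive first letter
  -- multiplies it by `p m`, and the tails multiply by `Z-starPlusW`.
  Z-circledastW : ∀ u v → Positive u → ValidWord v → ∀ b →
    ext (λ w → Z w b) (circledastW u (1 ∷ v)) ≈ ∑ b (λ m → Top u m * (p m * Z v m))
  Z-circledastW (suc i ∷ u) v (_ , _ ∷ valid-u) valid-v b rewrite ℕₚ.+-comm i 1 =
    trans (ext-Z-prefixH b _ (starPlusW u v)) (∑-cong b (λ m →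
      trans (*-congˡ (Z-starPlusW u v valid-u valid-v m))
        (solve 5 (λ P x i y z → P :* x :* i :* (y :* z) := x :* i :* y :* (P :* z)) refl (p m) _ (ι m) (Z u m) (Z v m))))
  Z-circledastW (zero ∷ u) v (_ , () ∷ _)

  -- The weakly decreasing sums of the powers of p: keeping the bound `suc N` for the tail lets
  -- consecutive indices be equal.
  S : Word → ℕ → Carrier
  S [] N = 1#
  S (k ∷ w) zero = 0#
  S (k ∷ w) (suc N) = S (k ∷ w) N + p N ^ k * S w (suc N)

  ext-S-suc : ∀ N k h → ext (λ w → S w (suc N)) (prefixH k h) ≈
    ext (λ w → S w N) (prefixH k h) + p N ^ k * ext (λ w → S w (suc N)) h
  ext-S-suc N k h = begin
    ext (λ w → S w (suc N)) (prefixH k h)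
      ≈⟨ ext-prefixH _ k h ⟩
    ext (λ w → S (k ∷ w) N + p N ^ k * S w (suc N)) h
      ≈⟨ ext-+ _ _ h ⟩
    ext (λ w → S (k ∷ w) N) h + ext (λ w → p N ^ k * S w (suc N)) h
      ≈⟨ +-cong (ext-prefixH _ k h) (sym (ext-*ˡ (p N ^ k) _ h)) ⟨
    ext (λ w → S w N) (prefixH k h) + p N ^ k * ext (λ w → S w (suc N)) h ∎

  ext-starBarW : ∀ g i u j v → ext g (starBarW (i ∷ u) (j ∷ v)) ≈
    ext g (prefixH i (starBarW u (j ∷ v))) + (ext g (prefixH j (starBarW (i ∷ u) v)) -
    ext g (prefixH (i ℕ.+ j) (starBarW u v)))
  ext-starBarW g i u j v =
    trans (ext-++ g (prefixH i (starBarW u (j ∷ v))) _) (+-congˡ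
    (trans (ext-++ g (prefixH j (starBarW (i ∷ u) v)) _) (+-congˡ
    (trans (ext-scaleH g pMinusOne (prefixH (i ℕ.+ j) (starBarW u v))) (trans (*-congʳ ⟦⟧-pMinusOne)
      (solve 1 (λ x → :- con (1 , 0) :* x := :- x) refl _))))))

  -- Inclusion and exclusion: with weak inequalities the case of equal largest indices lies in both
  -- of the first two terms of `starBarW`, and the third removes it once.
  S-starBarW : ∀ u v N → ext (λ w → S w N) (starBarW u v) ≈ S u N * S v N
  S-starBarW [] v N = trans (ext-wordH (λ w → S w N) v) (sym (*-identityˡ _))
  S-starBarW (i ∷ u) [] N = trans (ext-wordH (λ w → S w N) (i ∷ u)) (sym (*-identityʳ _))
  S-starBarW (i ∷ u) (j ∷ v) zero = trans (ext-starBarW _ i u j v) (trans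
    (+-cong (zero-prefix i (starBarW u (j ∷ v))) (+-cong (zero-prefix j (starBarW (i ∷ u) v))
      (-‿cong (zero-prefix (i ℕ.+ j) (starBarW u v)))))
    (solve 0 (con (0 , 0) :+ (con (0 , 0) :- con (0 , 0)) := con (0 , 0) :* con (0 , 0)) refl))
    where
    zero-prefix : ∀ k h → ext (λ w → S w 0) (prefixH k h) ≈ 0#
    zero-prefix k h = trans (ext-prefixH _ k h) (ext-zero h)
  S-starBarW (i ∷ u) (j ∷ v) (suc N) = begin
    ext (λ w → S w (suc N)) (starBarW (i ∷ u) (j ∷ v))
      ≈⟨ ext-starBarW _ i u j v ⟩
    ext (λ w → S w (suc N)) (prefixH i U) + (ext (λ w → S w (suc N)) (prefixH j V) -
      ext (λ w → S w (suc N)) (prefixH (i ℕ.+ j) UV))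
      ≈⟨ +-cong (ext-S-suc N i U) (+-cong (ext-S-suc N j V) (-‿cong (ext-S-suc N (i ℕ.+ j) UV))) ⟩
    X₁ + x * Y₁ + (X₂ + y * Y₂ - (X₃ + p N ^ (i ℕ.+ j) * Y₃))
      ≈⟨ solve 9 (λ X₁ X₂ X₃ Y₁ Y₂ Y₃ a b c →
           X₁ :+ a :* Y₁ :+ (X₂ :+ b :* Y₂ :- (X₃ :+ c :* Y₃))
           := X₁ :+ (X₂ :- X₃) :+ a :* Y₁ :+ b :* Y₂ :- c :* Y₃)
           refl X₁ X₂ X₃ Y₁ Y₂ Y₃ _ _ _ ⟩
    X₁ + (X₂ - X₃) + x * Y₁ + y * Y₂ - p N ^ (i ℕ.+ j) * Y₃
      ≈⟨ +-cong (+-cong (+-cong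
           (trans (sym (ext-starBarW _ i u j v)) (S-starBarW (i ∷ u) (j ∷ v) N))
           (*-congˡ (S-starBarW u (j ∷ v) (suc N))))
           (*-congˡ (S-starBarW (i ∷ u) v (suc N))))
           (-‿cong (*-cong (^-homo-* (p N) i j) (S-starBarW u v (suc N)))) ⟩
    A * B′ + x * (s * (B′ + y * t)) + y * ((A + x * s) * t) - x * y * (s * t)
      ≈⟨ solve 6 (λ A B x y s t → A :* B :+ x :* (s :* (B :+ y :* t)) :+ y :* ((A :+ x :* s) :* t) :- x :* y :* (s :* t)
           := (A :+ x :* s) :* (B :+ y :* t)) refl A B′ x y s t ⟩
    S (i ∷ u) (suc N) * S (j ∷ v) (suc N) ∎
    where
    U V UV : H
    U = starBarW u (j ∷ v)
    V = starBarW (i ∷ u) v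
    UV = starBarW u v
    X₁ X₂ X₃ Y₁ Y₂ Y₃ A B′ x y s t : Carrier
    X₁ = ext (λ w → S w N) (prefixH i U)
    X₂ = ext (λ w → S w N) (prefixH j V)
    X₃ = ext (λ w → S w N) (prefixH (i ℕ.+ j) UV)
    Y₁ = ext (λ w → S w (suc N)) U
    Y₂ = ext (λ w → S w (suc N)) V
    Y₃ = ext (λ w → S w (suc N)) UV
    A = S (i ∷ u) N
    B′ = S (j ∷ v) N
    x = p N ^ i
    y = p N ^ j
    s = S u (suc N)
    t = S v (suc N)

-- The transform of the top parts under φ

module Duality (Q : QRing) where
  open QRing Q
  open Solver R
  open Sums R
  open LinearExtension Q
  open NewtonBasis Q
  open HarmonicSums Q
  open SetoidReasoning setoid
  open SemiringExp semiring using (_^_; ^-homo-*)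

  topD : Word → ℕ → Carrier
  topD w m = ext (λ v → Top v m) (dW w)

  belowD : Word → ℕ → Carrier
  belowD w b = ext (λ v → Z v b) (dW w)

  belowD≈∑topD : ∀ w → Positive w → ∀ b → belowD w b ≈ ∑ b (topD w)
  belowD≈∑topD w pos b = trans
    (ext-cong (dW w) (dW-positive w pos) (λ v pos-v → Z≈∑Top v (proj₁ pos-v) b))
    (ext-∑ b (λ m v → Top v m) (dW w))

  ext-Top-circH : ∀ i h m → AllWords ValidWord h →
    ext (λ v → Top v m) (circH i h) ≈ p m ^ i * ext (λ v → Top v m) h
  ext-Top-circH i h m valid = trans (ext-lin (λ v → Top v m) (circW i) h)
    (trans (ext-cong h valid on-words) (ext-*ˡ (p m ^ i) (λ v → Top v m) h))
    where
    on-words : ∀ w → ValidWord w → ext (λ v → Top v m) (circW i w) ≈ p m ^ i * Top w m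
    on-words [] _ = sym (zeroʳ _)
    on-words (suc j ∷ w) _ = trans (ext-wordH (λ v → Top v m) (i ℕ.+ suc j ∷ w)) shifted
      where
      shifted : letter (i ℕ.+ suc j) m * Z w m ≈ p m ^ i * (p m ^ j * ι m * Z w m)
      shifted rewrite ℕₚ.+-suc i j = trans (*-congʳ (*-congʳ (^-homo-* (p m) i j)))
        (solve 4 (λ x y i z → x :* y :* i :* z := x :* (y :* i :* z)) refl _ _ _ _)
    on-words (zero ∷ w) (() ∷ _)

  -- The map `d` either keeps the first letter apart, leaving smaller indices to the tail, or merges
  -- it into the next letter, which costs only a factor `p m ^ i`: of the letters merged at one
  -- index, the last alone carries an extra 1/[m+1].
  topD-cons : ∀ i w m → ValidWord w → topD (i ∷ w) m ≈ letter i m * belowD w m + p m ^ i * topD w m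
  topD-cons i w m valid = begin
    topD (i ∷ w) m
      ≈⟨ ext-++ (λ v → Top v m) (prefixH i (dW w)) (circH i (dW w)) ⟩
    ext (λ v → Top v m) (prefixH i (dW w)) + ext (λ v → Top v m) (circH i (dW w))
      ≈⟨ +-cong (trans (ext-prefixH (λ v → Top v m) i (dW w)) (ext-*ˡ (letter i m) (λ v → Z v m) (dW w)))
           (ext-Top-circH i (dW w) m (dW-valid w valid)) ⟩
    letter i m * belowD w m + p m ^ i * topD w m ∎

  topD-unit : ∀ m → topD (1 ∷ []) m ≈ ι m
  topD-unit m = trans (topD-cons 1 [] m [])
    (trans (+-cong (*-congˡ (ext-wordH (λ v → Z v m) [])) (*-congˡ (ext-wordH (λ v → Top v m) [])))
      (solve 2 (λ i p → con (1 , 0) :* i :* con (1 , 0) :+ p :* con (1 , 0) :* con (0 , 0) := i) refl (ι m) (p m)))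

  topD-bump : ∀ w → Positive w → ∀ m → topD (bump w) m ≈ p m * topD w m
  topD-bump (suc i ∷ w) (_ , _ ∷ valid) m = begin
    topD (suc (suc i) ∷ w) m
      ≈⟨ topD-cons (suc (suc i)) w m valid ⟩
    p m * p m ^ i * ι m * belowD w m + p m * p m ^ suc i * topD w m
      ≈⟨ solve 6 (λ P x i b y t → P :* x :* i :* b :+ P :* y :* t := P :* (x :* i :* b :+ y :* t)) refl _ _ _ _ _ _ ⟩
    p m * (p m ^ i * ι m * belowD w m + p m ^ suc i * topD w m)
      ≈⟨ *-congˡ (topD-cons (suc i) w m valid) ⟨
    p m * topD (suc i ∷ w) m ∎
  topD-bump (zero ∷ w) (_ , () ∷ _) m

  -- Exactly the combination of strict partial sums and diagonal terms that `E-partial-sums`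
  -- evaluates.
  topD-one : ∀ w → Positive w → ∀ m → topD (1 ∷ w) m ≈ ι m * ∑ m (topD w) + p m * topD w m
  topD-one w pos m = trans (topD-cons 1 w m (proj₂ pos))
    (+-cong (*-cong (*-identityˡ _) (belowD≈∑topD w pos m)) (*-congʳ (*-identityʳ _)))

  topS : Word → ℕ → Carrier
  topS [] N = 0#
  topS (k ∷ w) N = p N ^ k * S w (suc N)

  S≈∑topS : ∀ k w N → S (k ∷ w) N ≈ ∑ N (topS (k ∷ w))
  S≈∑topS k w zero = refl
  S≈∑topS k w (suc N) = +-congʳ (S≈∑topS k w N)

  -- The Newton transform E exchanges the two ways of building a composition:
  -- multiplication by p and partial summation.
  duality : ∀ {w} → Composition w → ∀ N → q ^ suc N * E (topD (phiW w)) N ≈ topS w N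
  duality unit N = trans (*-congˡ (trans (E-cong N topD-unit) (E-ι N)))
    (solve 1 (λ x → x := x :* con (1 , 0) :* con (1 , 0)) refl (p N))
  duality (extend {k} {w} c) N rewrite phiW-extend k w = begin
    q ^ suc N * E (topD (bump U)) N
      ≈⟨ *-congˡ (trans (E-cong N (topD-bump U (phiW-positive c))) (E-p (topD U) N)) ⟩
    q ^ suc N * (- ι N * B (topD U) (suc N))
      ≈⟨ *-congˡ (*-congˡ (B≈-∑E (topD U) (suc N))) ⟩
    q ^ suc N * (- ι N * - ∑ (suc N) (λ i → q ^ suc i * E (topD U) i))
      ≈⟨ *-congˡ (*-congˡ (-‿cong (∑-cong (suc N) (duality c)))) ⟩
    q ^ suc N * (- ι N * - ∑ (suc N) (topS (k ∷ w)))
      ≈⟨ solve 3 (λ t i x → t :* (:- i :* :- x) := t :* i :* con (1 , 0) :* x) refl _ _ _ ⟩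
    p N ^ 1 * ∑ (suc N) (topS (k ∷ w))
      ≈⟨ *-congˡ (S≈∑topS k w (suc N)) ⟨
    p N ^ 1 * S (k ∷ w) (suc N) ∎
    where
    U : Word
    U = phiW (k ∷ w)
  duality (raise {k} {w} c) N rewrite phiW-raise k w = begin
    q ^ suc N * E (topD (1 ∷ U)) N
      ≈⟨ *-congˡ (trans (E-cong N (topD-one U (phiW-positive c))) (E-partial-sums (topD U) N)) ⟩
    q ^ suc N * (p N * E (topD U) N)
      ≈⟨ solve 3 (λ t x e → t :* (x :* e) := x :* (t :* e)) refl _ (p N) _ ⟩
    p N * (q ^ suc N * E (topD U) N)
      ≈⟨ *-congˡ (duality c N) ⟩
    p N * (p N ^ suc k * S w (suc N))
      ≈⟨ *-assoc _ _ _ ⟨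
    p N ^ suc (suc k) * S w (suc N) ∎
    where
    U : Word
    U = phiW (suc k ∷ w)

  -- Summing the duality over the indices below N leads from `E` back to `B`, hence to the values of
  -- the generating polynomial.
  B-topD : ∀ w → Positive w → ∀ N → B (topD (phiW w)) N ≈ - S w N
  B-topD (k ∷ w) pos N = trans (B≈-∑E (topD (phiW (k ∷ w))) N)
    (-‿cong (trans (∑-cong N (duality (composition (k ∷ w) pos))) (sym (S≈∑topS k w N))))

-- Generating polynomials and the truncated relation

module GeneratingPolynomials (Q : QRing) where
  open QRing Q
  open Solver R
  open Sums R
  open Polynomials R
  open Divisibility R q
  open LinearExtension Q
  open NewtonBasis Q
  open HarmonicSums Q
  open Duality Q
  open SetoidReasoning setoid
  open SemiringExp semiring using (_^_)

  -- partialProduct m = qᵐ ∏_{0<l≤m} (1 + x/[l])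
  partialProduct : ℕ → Polynomial
  partialProduct zero = 1# ∷ []
  partialProduct (suc m) = (q ∷ q * ι m ∷ []) ⊠ partialProduct m

  -- The polynomial A_(m+1)(x) of the overview.
  newton : ℕ → Polynomial
  newton m = (0# ∷ q * ι m ∷ []) ⊠ partialProduct m

  q∣q : q^ 1 ∣ q
  q∣q = 1# , solve 1 (λ q → q := q :* con (1 , 0) :* con (1 , 0)) refl q

  q∣qι : ∀ m → q^ 1 ∣ q * ι m
  q∣qι m = ι m , solve 2 (λ q i → q :* i := q :* con (1 , 0) :* i) refl q (ι m)

  -- The power q^m is dealt out as one q per linear factor, and each q + (q/[l]) x has tilt 0 by
  -- itself.
  tilted-partialProduct : ∀ m → Tilted 0 (partialProduct m)
  tilted-partialProduct zero = (1# , sym (*-identityˡ 1#)) , tt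
  tilted-partialProduct (suc m) =
    tilted-⊠ 0 0 (q ∷ q * ι m ∷ []) (partialProduct m) (∣-weaken 0 q∣q , q∣qι m , tt) (tilted-partialProduct m)

  tilted-newton : ∀ m → Tilted 0 (newton m)
  tilted-newton m =
    tilted-⊠ 0 0 (0# ∷ q * ι m ∷ []) (partialProduct m) (∣-zero 0 , q∣qι m , tt) (tilted-partialProduct m)

  -- Passing from m to m + 1 multiplies the value by q ([m+1] - [N])/[m+2], which is the quotient in
  -- `a-ratio`.
  eval-newton : ∀ N m → eval (- bracket N) (newton m) ≈ a (suc m) N
  eval-newton N zero = begin
    eval x (newton 0)
      ≈⟨ eval-⊠ x (0# ∷ q * ι 0 ∷ []) (partialProduct 0) ⟩
    (0# + x * (q * ι 0 + x * 0#)) * (1# + x * 0#)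
      ≈⟨ solve 3 (λ b q i → (con (0 , 0) :+ :- b :* (q :* i :+ :- b :* con (0 , 0))) :* (con (1 , 0) :+ :- b :* con (0 , 0))
           := i :* (q :* (con (0 , 0) :- b) :* con (1 , 0))) refl (bracket N) q (ι 0) ⟩
    ι 0 * (q * (0# - bracket N) * 1#)
      ≈⟨ bracket-cancel 0 (a-ratio 0 N) ⟨
    a 1 N ∎
    where
    x : Carrier
    x = - bracket N
  eval-newton N (suc m) = begin
    eval x (newton (suc m))
      ≈⟨ eval-⊠ x (0# ∷ q * ι (suc m) ∷ []) (partialProduct (suc m)) ⟩
    (0# + x * (q * ι (suc m) + x * 0#)) * eval x (partialProduct (suc m))
      ≈⟨ *-congˡ (eval-⊠ x (q ∷ q * ι m ∷ []) (partialProduct m)) ⟩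
    (0# + x * (q * ι (suc m) + x * 0#)) * ((q + x * (q * ι m + x * 0#)) * F)
      ≈⟨ solve 5 (λ b q i j f →
           (con (0 , 0) :+ :- b :* (q :* j :+ :- b :* con (0 , 0))) :* ((q :+ :- b :* (q :* i :+ :- b :* con (0 , 0))) :* f)
           := j :* (q :* (con (1 , 0) :- b :* i) :* (q :* :- b :* f))) refl (bracket N) q (ι m) (ι (suc m)) F ⟩
    ι (suc m) * (q * (1# - bracket N * ι m) * (q * - bracket N * F))
      ≈⟨ *-congˡ (*-congʳ (*-congˡ (+-congʳ (bracket-ι m)))) ⟨
    ι (suc m) * (q * (bracket (suc m) * ι m - bracket N * ι m) * (q * - bracket N * F))
      ≈⟨ solve 6 (λ b c q i j f → j :* (q :* (c :* i :- b :* i) :* (q :* :- b :* f))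
           := j :* (q :* (c :- b) :* ((con (0 , 0) :+ :- b :* (q :* i :+ :- b :* con (0 , 0))) :* f)))
           refl (bracket N) (bracket (suc m)) q (ι m) (ι (suc m)) F ⟩
    ι (suc m) * (q * (bracket (suc m) - bracket N) * ((0# + x * (q * ι m + x * 0#)) * F))
      ≈⟨ *-congˡ (*-congˡ (eval-⊠ x (0# ∷ q * ι m ∷ []) (partialProduct m))) ⟨
    ι (suc m) * (q * (bracket (suc m) - bracket N) * eval x (newton m))
      ≈⟨ *-congˡ (*-congˡ (eval-newton N m)) ⟩
    ι (suc m) * (q * (bracket (suc m) - bracket N) * a (suc m) N)
      ≈⟨ bracket-cancel (suc m) (a-ratio (suc m) N) ⟨
    a (suc (suc m)) N ∎
    where
    x F : Carrier
    x = - bracket N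
    F = eval x (partialProduct m)

  coef-linear-zero : ∀ b c P → coef ((b ∷ c ∷ []) ⊠ P) 0 ≈ b * coef P 0
  coef-linear-zero b c P = trans (coef-⊞ (b ◃ P) _ 0) (trans (+-identityʳ _) (coef-◃ b P 0))

  coef-linear-suc : ∀ b c P n → coef ((b ∷ c ∷ []) ⊠ P) (suc n) ≈ b * coef P (suc n) + c * coef P n
  coef-linear-suc b c P n = begin
    coef ((b ∷ c ∷ []) ⊠ P) (suc n)
      ≈⟨ coef-⊞ (b ◃ P) (0# ∷ ((c ∷ []) ⊠ P)) (suc n) ⟩
    coef (b ◃ P) (suc n) + coef ((c ◃ P) ⊞ (0# ∷ [])) n
      ≈⟨ +-cong (coef-◃ b P (suc n)) (coef-⊞ (c ◃ P) (0# ∷ []) n) ⟩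
    b * coef P (suc n) + (coef (c ◃ P) n + coef (0# ∷ []) n)
      ≈⟨ +-congˡ (+-cong (coef-◃ c P n) (zero-coef n)) ⟩
    b * coef P (suc n) + (c * coef P n + 0#)
      ≈⟨ +-congˡ (+-identityʳ _) ⟩
    b * coef P (suc n) + c * coef P n ∎
    where
    zero-coef : ∀ n → coef (0# ∷ []) n ≈ 0#
    zero-coef zero = refl
    zero-coef (suc n) = refl

  -- The nested sums over a word of n ones are the elementary symmetric functions of 1/[1], ...,
  -- 1/[m].
  coef-partialProduct : ∀ m n → coef (partialProduct m) n ≈ q ^ m * Z (replicate n 1) m
  coef-partialProduct zero zero = sym (*-identityˡ 1#)
  coef-partialProduct zero (suc n) = sym (zeroʳ _)
  coef-partialProduct (suc m) zero = trans (coef-linear-zero q (q * ι m) (partialProduct m))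
    (trans (*-congˡ (coef-partialProduct m zero)) (sym (*-assoc _ _ _)))
  coef-partialProduct (suc m) (suc n) = trans (coef-linear-suc q (q * ι m) (partialProduct m) n)
    (trans (+-cong (*-congˡ (coef-partialProduct m (suc n))) (*-congˡ (coef-partialProduct m n)))
      (solve 5 (λ q t i x y → q :* (t :* x) :+ q :* i :* (t :* y) := q :* t :* (x :+ con (1 , 0) :* i :* y))
        refl q (q ^ m) (ι m) _ _))

  coef-newton-zero : ∀ m → coef (newton m) 0 ≈ 0#
  coef-newton-zero m = trans (coef-linear-zero 0# (q * ι m) (partialProduct m)) (zeroˡ _)

  coef-newton-suc : ∀ m n → coef (newton m) (suc n) ≈ p m * Z (replicate n 1) m
  coef-newton-suc m n = trans (coef-linear-suc 0# (q * ι m) (partialProduct m) n)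
    (trans (+-congˡ (*-congˡ (coef-partialProduct m n)))
      (solve 5 (λ q t i x y → con (0 , 0) :* x :+ q :* i :* (t :* y) := q :* t :* i :* y) refl q (q ^ m) (ι m) _ _))

  combination : (ℕ → Carrier) → ℕ → Polynomial
  combination c zero = []
  combination c (suc M) = combination c M ⊞ (c M ◃ newton M)

  tilted-combination : ∀ c M → Tilted 0 (combination c M)
  tilted-combination c zero = tt
  tilted-combination c (suc M) = tilted-⊞ 0 (combination c M) (c M ◃ newton M) (tilted-combination c M)
    (tilted-◃ 0 0 (c M) (newton M) (c M , sym (*-identityˡ _)) (tilted-newton M))

  coef-combination : ∀ c M n → coef (combination c M) n ≈ ∑ M (λ m → c m * coef (newton m) n)
  coef-combination c zero n = refl
  coef-combination c (suc M) n = trans (coef-⊞ (combination c M) (c M ◃ newton M) n)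
    (+-cong (coef-combination c M n) (coef-◃ (c M) (newton M) n))

  -- The polynomials with index N or more contain the factor 1 + x/[N], or x when N = 0, and drop
  -- out at -[N]; the value is therefore the same for every M ≥ N.
  eval-combination : ∀ c M N → N ≤ M → eval (- bracket N) (combination c M) ≈ B c N
  eval-combination c M N N≤M = trans (all-terms M) (truncate (ℕₚ.≤⇒≤′ N≤M))
    where
    all-terms : ∀ M → eval (- bracket N) (combination c M) ≈ ∑ M (λ m → c m * a (suc m) N)
    all-terms zero = refl
    all-terms (suc M) = trans (eval-⊞ (- bracket N) (combination c M) (c M ◃ newton M))
      (+-cong (all-terms M) (trans (eval-◃ (- bracket N) (c M) (newton M)) (*-congˡ (eval-newton N M))))

    truncate : ∀ {M} → N ℕ.≤′ M → ∑ M (λ m → c m * a (suc m) N) ≈ B c N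
    truncate (ℕ.≤′-reflexive ≡.refl) = refl
    truncate (ℕ.≤′-step N≤′M) = trans
      (+-cong (truncate N≤′M) (trans (*-congˡ (a-above (s≤s (ℕₚ.≤′⇒≤ N≤′M)))) (zeroʳ _)))
      (+-identityʳ _)

  topDφ : H → ℕ → Carrier
  topDφ h m = ext (λ w → Top w m) (d (phi h))

  genPoly : ℕ → H → Polynomial
  genPoly M h = combination (topDφ h) M

  eval-genPoly : ∀ M N h → N ≤ M → InH1pos h → eval (- bracket N) (genPoly M h) ≈ - ext (λ w → S w N) h
  eval-genPoly M N h N≤M pos = begin
    eval (- bracket N) (genPoly M h)
      ≈⟨ eval-combination (topDφ h) M N N≤M ⟩
    ∑ N (λ m → topDφ h m * a (suc m) N)
      ≈⟨ ∑-cong N (λ m → *-congʳ (topDφ-on-words m)) ⟩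
    ∑ N (λ m → ext (λ w → topD (phiW w) m) h * a (suc m) N)
      ≈⟨ ∑-cong N (λ m → ext-*ʳ (a (suc m) N) (λ w → topD (phiW w) m) h) ⟨
    ∑ N (λ m → ext (λ w → topD (phiW w) m * a (suc m) N) h)
      ≈⟨ ext-∑ N (λ m w → topD (phiW w) m * a (suc m) N) h ⟨
    ext (λ w → B (topD (phiW w)) N) h
      ≈⟨ ext-cong h pos (λ w pos-w → trans (B-topD w pos-w N)
           (solve 1 (λ x → :- x := :- con (1 , 0) :* x) refl _)) ⟩
    ext (λ w → - 1# * S w N) h
      ≈⟨ ext-*ˡ (- 1#) (λ w → S w N) h ⟩
    - 1# * ext (λ w → S w N) h
      ≈⟨ solve 1 (λ x → :- con (1 , 0) :* x := :- x) refl _ ⟩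
    - ext (λ w → S w N) h ∎
    where
    topDφ-on-words : ∀ m → topDφ h m ≈ ext (λ w → topD (phiW w) m) h
    topDφ-on-words m = begin
      ext (λ w → Top w m) (lin dW (phi h))
        ≈⟨ ext-lin (λ w → Top w m) dW (phi h) ⟩
      ext (λ w → topD w m) (phi h)
        ≈⟨ ext-lin (λ w → topD w m) (λ w → wordH (phiW w)) h ⟩
      ext (λ w → ext (λ v → topD v m) (wordH (phiW w))) h
        ≈⟨ ext-cong-everywhere h (λ w → ext-wordH (λ v → topD v m) (phiW w)) ⟩
      ext (λ w → topD (phiW w) m) h ∎

  truncatedZeta : ℕ → H → ℕ → Carrier
  truncatedZeta M h n = ext (λ w → Z w M) (circledast (d (phi h)) (z1pow n))

  coef-genPoly-zero : ∀ M h → coef (genPoly M h) 0 ≈ 0#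
  coef-genPoly-zero M h = trans (coef-combination (topDφ h) M 0)
    (trans (∑-cong M (λ m → trans (*-congˡ (coef-newton-zero m)) (zeroʳ _))) (∑-zero M))

  coef-genPoly-suc : ∀ M h n → InH1pos h → coef (genPoly M h) (suc n) ≈ truncatedZeta M h (suc n)
  coef-genPoly-suc M h n pos = begin
    coef (genPoly M h) (suc n)
      ≈⟨ coef-combination (topDφ h) M (suc n) ⟩
    ∑ M (λ m → topDφ h m * coef (newton m) (suc n))
      ≈⟨ ∑-cong M (λ m → trans (*-congˡ (coef-newton-suc m n))
           (sym (ext-*ʳ (p m * Z v m) (λ u → Top u m) (d (phi h))))) ⟩
    ∑ M (λ m → ext (λ u → Top u m * (p m * Z v m)) (d (phi h)))
      ≈⟨ ext-∑ M (λ m u → Top u m * (p m * Z v m)) (d (phi h)) ⟨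
    ext (λ u → ∑ M (λ m → Top u m * (p m * Z v m))) (d (phi h))
      ≈⟨ ext-cong (d (phi h)) (dφ-positive h pos) (λ u pos-u →
           trans (ext-wordH (λ v → ext (λ w → Z w M) (circledastW u v)) (1 ∷ v))
             (Z-circledastW u v pos-u (replicate-valid n) M)) ⟨
    ext (λ u → ext (λ v → ext (λ w → Z w M) (circledastW u v)) (z1pow (suc n))) (d (phi h))
      ≈⟨ ext-bilin (λ w → Z w M) circledastW (d (phi h)) (z1pow (suc n)) ⟨
    truncatedZeta M h (suc n) ∎
    where
    v : Word
    v = replicate n 1

  bracket-+ : ∀ i j → bracket (i ℕ.+ j) ≈ bracket i + q ^ i * bracket j
  bracket-+ zero j = solve 1 (λ b → b := con (0 , 0) :+ con (1 , 0) :* b) refl (bracket j)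
  bracket-+ (suc i) j = trans (+-congˡ (*-congˡ (bracket-+ i j)))
    (solve 4 (λ q b t c → con (1 , 0) :+ q :* (b :+ t :* c) := con (1 , 0) :+ q :* b :+ q :* t :* c) refl q _ (q ^ i) _)

  q^-cancel : ∀ k x → q ^ k * x ≈ 0# → x ≈ 0#
  q^-cancel zero x e = trans (sym (*-identityˡ x)) e
  q^-cancel (suc k) x e = q^-cancel k x (q-cancel _ (trans (sym (*-assoc _ _ _)) e))

  -- The difference of the two roots is -q^i [j+1], a unit times a power of the cancellable element
  -- q.
  roots-cancel : ∀ i j x → (- bracket (suc (i ℕ.+ j)) - - bracket i) * x ≈ 0# → x ≈ 0#
  roots-cancel i j x e = trans (bracket-cancel j (q^-cancel i _ (begin
    q ^ i * (bracket (suc j) * x)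
      ≈⟨ solve 4 (λ t b c x → t :* (c :* x) := :- ((:- (b :+ t :* c) :- :- b) :* x))
           refl (q ^ i) (bracket i) (bracket (suc j)) x ⟩
    - ((- (bracket i + q ^ i * bracket (suc j)) - - bracket i) * x)
      ≈⟨ -‿cong (*-congʳ (+-congʳ (-‿cong
           (trans (reflexive (≡.cong bracket (≡.sym (ℕₚ.+-suc i j)))) (bracket-+ i (suc j)))))) ⟨
    - ((- bracket (suc (i ℕ.+ j)) - - bracket i) * x)
      ≈⟨ -‿cong e ⟩
    - 0#
      ≈⟨ solve 0 (:- con (0 , 0) := con (0 , 0)) refl ⟩
    0# ∎))) (zeroʳ _)

  truncated-relation : ∀ M g h → InH1pos g → InH1pos h → ∀ n →
    q^ suc M ∣ truncatedZeta M (starBar g h) (suc n)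
      + ∑ n (λ k → truncatedZeta M g (suc k) * truncatedZeta M h (n ∸ k))
  truncated-relation M g h pos-g pos-h n = ∣-resp (suc M) coefficient
    -- The roots -[0], ..., -[M] are M + 1 in number and the initial tilt is 0, whence the exponent
    -- M + 1.
    (coef-divisible-by-roots (λ N → - bracket N) roots-cancel (suc M) 0 0 P
      (tilted-⊞ 0 (genPoly M gh) (genPoly M g ⊠ genPoly M h) (tilted-combination (topDφ gh) M)
        (tilted-⊠ 0 0 (genPoly M g) (genPoly M h) (tilted-combination (topDφ g) M) (tilted-combination (topDφ h) M)))
      (λ N N<1+M → vanishes N (ℕₚ.≤-pred N<1+M)) (suc n))
    where
    gh : H
    gh = starBar g h
    P : Polynomial
    P = genPoly M gh ⊞ (genPoly M g ⊠ genPoly M h)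

    vanishes : ∀ N → N ≤ M → eval (- bracket N) P ≈ 0#
    vanishes N N≤M = begin
      eval r P
        ≈⟨ trans (eval-⊞ r (genPoly M gh) _) (+-congˡ (eval-⊠ r (genPoly M g) (genPoly M h))) ⟩
      eval r (genPoly M gh) + eval r (genPoly M g) * eval r (genPoly M h)
        ≈⟨ +-cong (eval-genPoly M N gh N≤M (starBar-positive g h pos-g pos-h))
             (*-cong (eval-genPoly M N g N≤M pos-g) (eval-genPoly M N h N≤M pos-h)) ⟩
      - ext (λ w → S w N) gh + - ext (λ w → S w N) g * - ext (λ w → S w N) h
        ≈⟨ +-congʳ (-‿cong (ext-multiplicative (λ w → S w N) starBarW (λ u v → S-starBarW u v N) g h)) ⟩
      - (ext (λ w → S w N) g * ext (λ w → S w N) h) + - ext (λ w → S w N) g * - ext (λ w → S w N) h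
        ≈⟨ solve 2 (λ x y → :- (x :* y) :+ :- x :* :- y := con (0 , 0)) refl _ _ ⟩
      0# ∎
      where
      r : Carrier
      r = - bracket N

    f : ℕ → Carrier
    f k = coef (genPoly M g) k * coef (genPoly M h) (suc n ∸ k)

    -- Each Newton polynomial is divisible by x, so both end terms of the Cauchy product vanish and
    -- the indices k, l ≥ 1 remain.
    last-term : f (suc n) ≈ 0#
    last-term = trans (*-congˡ (trans (reflexive (≡.cong (coef (genPoly M h)) (ℕₚ.n∸n≡0 n)))
      (coef-genPoly-zero M h))) (zeroʳ _)

    coef-of-positive : ∀ {m} → 1 ≤ m → coef (genPoly M h) m ≈ truncatedZeta M h m
    coef-of-positive {suc m} _ = coef-genPoly-suc M h m pos-h

    middle-term : ∀ k → k < n → f (suc k) ≈ truncatedZeta M g (suc k) * truncatedZeta M h (n ∸ k)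
    middle-term k k<n = *-cong (coef-genPoly-suc M g k pos-g) (coef-of-positive (ℕₚ.m<n⇒0<n∸m k<n))

    coefficient : coef P (suc n) ≈ truncatedZeta M gh (suc n)
      + ∑ n (λ k → truncatedZeta M g (suc k) * truncatedZeta M h (n ∸ k))
    coefficient = begin
      coef P (suc n)
        ≈⟨ coef-⊞ (genPoly M gh) _ (suc n) ⟩
      coef (genPoly M gh) (suc n) + coef (genPoly M g ⊠ genPoly M h) (suc n)
        ≈⟨ +-cong (coef-genPoly-suc M gh n (starBar-positive g h pos-g pos-h)) (coef-⊠ (genPoly M g) (genPoly M h) (suc n)) ⟩
      truncatedZeta M gh (suc n) + (∑ (suc n) f + f (suc n))
        ≈⟨ +-congˡ (trans (+-cong (∑-head n f) last-term) (+-identityʳ _)) ⟩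
      truncatedZeta M gh (suc n) + (f 0 + ∑ n (f ∘ suc))
        ≈⟨ +-congˡ (trans (+-congʳ (trans (*-congʳ (coef-genPoly-zero M g)) (zeroˡ _))) (+-identityˡ _)) ⟩
      truncatedZeta M gh (suc n) + ∑ n (f ∘ suc)
        ≈⟨ +-congˡ (∑-cong-below n middle-term) ⟩
      truncatedZeta M gh (suc n) + ∑ n (λ k → truncatedZeta M g (suc k) * truncatedZeta M h (n ∸ k)) ∎

-- The ring of formal power series over ℚ

module Convolution where
  open ≡.≡-Reasoning
  open Solver ℚₚ.+-*-commutativeRing

  sumTo-cong : ∀ n {a b : ℕ → ℚ} → (∀ i → i ≤ n → a i ≡ b i) → sumTo n a ≡ sumTo n b
  sumTo-cong zero h = h 0 z≤n
  sumTo-cong (suc n) h =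
    ≡.cong₂ ℚ._+_ (sumTo-cong n (λ i i≤n → h i (ℕₚ.m≤n⇒m≤1+n i≤n))) (h (suc n) ℕₚ.≤-refl)

  sumTo-head : ∀ n a → sumTo (suc n) a ≡ a 0 ℚ.+ sumTo n (a ∘ suc)
  sumTo-head zero a = ≡.refl
  sumTo-head (suc n) a = ≡.trans (≡.cong (ℚ._+ a (suc (suc n))) (sumTo-head n a))
    (ℚₚ.+-assoc (a 0) (sumTo n (a ∘ suc)) (a (suc (suc n))))

  -- Writing f as its constant term plus q times `tail f` lets the ring laws be proved by induction
  -- on the exponent, without exchanging double sums.
  tail : PS → PS
  tail f = f ∘ suc

  ⊗-congᵖ : ∀ n {f f′ g g′ : PS} → (∀ i → i ≤ n → f i ≡ f′ i) → (∀ i → i ≤ n → g i ≡ g′ i) →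
    (f ⊗ g) n ≡ (f′ ⊗ g′) n
  ⊗-congᵖ n f≡f′ g≡g′ = sumTo-cong n (λ i i≤n → ≡.cong₂ ℚ._*_ (f≡f′ i i≤n) (g≡g′ (n ∸ i) (ℕₚ.m∸n≤m n i)))

  ⊗-head : ∀ f g n → (f ⊗ g) (suc n) ≡ f 0 ℚ.* g (suc n) ℚ.+ (tail f ⊗ g) n
  ⊗-head f g n = sumTo-head n (λ i → f i ℚ.* g (suc n ∸ i))

  ⊗-last : ∀ f g n → (f ⊗ g) (suc n) ≡ (f ⊗ tail g) n ℚ.+ f (suc n) ℚ.* g 0
  ⊗-last f g n = ≡.cong₂ ℚ._+_
    (sumTo-cong n (λ i i≤n → ≡.cong (λ k → f i ℚ.* g k) (ℕₚ.+-∸-assoc 1 i≤n)))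
    (≡.cong (λ k → f (suc n) ℚ.* g k) (ℕₚ.n∸n≡0 n))

  ⊗-commᵖ : ∀ f g n → (f ⊗ g) n ≡ (g ⊗ f) n
  ⊗-commᵖ f g zero = ℚₚ.*-comm (f 0) (g 0)
  ⊗-commᵖ f g (suc n) = begin
    (f ⊗ g) (suc n)                               ≡⟨ ⊗-head f g n ⟩
    f 0 ℚ.* g (suc n) ℚ.+ (tail f ⊗ g) n          ≡⟨ ≡.cong (f 0 ℚ.* g (suc n) ℚ.+_) (⊗-commᵖ (tail f) g n) ⟩
    f 0 ℚ.* g (suc n) ℚ.+ (g ⊗ tail f) n          ≡⟨ solve 3 (λ x y z → x :* y :+ z := z :+ y :* x) ≡.refl (f 0) (g (suc n)) _ ⟩
    (g ⊗ tail f) n ℚ.+ g (suc n) ℚ.* f 0          ≡⟨ ⊗-last g f n ⟨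
    (g ⊗ f) (suc n)                               ∎

  sumTo-+ : ∀ n a b → sumTo n (λ i → a i ℚ.+ b i) ≡ sumTo n a ℚ.+ sumTo n b
  sumTo-+ zero a b = ≡.refl
  sumTo-+ (suc n) a b = ≡.trans (≡.cong (ℚ._+ (a (suc n) ℚ.+ b (suc n))) (sumTo-+ n a b))
    (solve 4 (λ a b c d → (a :+ b) :+ (c :+ d) := (a :+ c) :+ (b :+ d)) ≡.refl
      (sumTo n a) (sumTo n b) (a (suc n)) (b (suc n)))

  ⊗-distribʳᵖ : ∀ f g h n → ((g ⊕ h) ⊗ f) n ≡ (g ⊗ f) n ℚ.+ (h ⊗ f) n
  ⊗-distribʳᵖ f g h n = ≡.trans
    (sumTo-cong n (λ i _ → ℚₚ.*-distribʳ-+ (f (n ∸ i)) (g i) (h i))) (sumTo-+ n _ _)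

  ⊗-scaleˡ : ∀ c f g n → ((λ i → c ℚ.* f i) ⊗ g) n ≡ c ℚ.* (f ⊗ g) n
  ⊗-scaleˡ c f g n = go n
    where
    go : ∀ m → sumTo m (λ i → c ℚ.* f i ℚ.* g (n ∸ i)) ≡ c ℚ.* sumTo m (λ i → f i ℚ.* g (n ∸ i))
    go zero = ℚₚ.*-assoc c _ _
    go (suc m) = ≡.trans (≡.cong₂ ℚ._+_ (go m) (ℚₚ.*-assoc c _ _)) (≡.sym (ℚₚ.*-distribˡ-+ c _ _))

  ⊗-assocᵖ : ∀ f g h n → ((f ⊗ g) ⊗ h) n ≡ (f ⊗ (g ⊗ h)) n
  ⊗-assocᵖ f g h zero = ℚₚ.*-assoc (f 0) (g 0) (h 0)
  ⊗-assocᵖ f g h (suc n) = begin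
    ((f ⊗ g) ⊗ h) (suc n)
      ≡⟨ ⊗-head (f ⊗ g) h n ⟩
    f 0 ℚ.* g 0 ℚ.* h (suc n) ℚ.+ (tail (f ⊗ g) ⊗ h) n
      ≡⟨ ≡.cong (f 0 ℚ.* g 0 ℚ.* h (suc n) ℚ.+_) (⊗-congᵖ n {g = h} (λ i _ → ⊗-head f g i) (λ _ _ → ≡.refl)) ⟩
    f 0 ℚ.* g 0 ℚ.* h (suc n) ℚ.+ (((λ i → f 0 ℚ.* tail g i) ⊕ (tail f ⊗ g)) ⊗ h) n
      ≡⟨ ≡.cong (f 0 ℚ.* g 0 ℚ.* h (suc n) ℚ.+_) (≡.trans
           (⊗-distribʳᵖ h (λ i → f 0 ℚ.* tail g i) (tail f ⊗ g) n)
           (≡.cong₂ ℚ._+_ (⊗-scaleˡ (f 0) (tail g) h n) (⊗-assocᵖ (tail f) g h n))) ⟩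
    f 0 ℚ.* g 0 ℚ.* h (suc n) ℚ.+ (f 0 ℚ.* (tail g ⊗ h) n ℚ.+ (tail f ⊗ (g ⊗ h)) n)
      ≡⟨ solve 5 (λ a b c x y → a :* b :* c :+ (a :* x :+ y) := a :* (b :* c :+ x) :+ y) ≡.refl (f 0) (g 0) (h (suc n)) _ _ ⟩
    f 0 ℚ.* (g 0 ℚ.* h (suc n) ℚ.+ (tail g ⊗ h) n) ℚ.+ (tail f ⊗ (g ⊗ h)) n
      ≡⟨ ≡.cong (λ x → f 0 ℚ.* x ℚ.+ (tail f ⊗ (g ⊗ h)) n) (⊗-head g h n) ⟨
    f 0 ℚ.* (g ⊗ h) (suc n) ℚ.+ (tail f ⊗ (g ⊗ h)) n
      ≡⟨ ⊗-head f (g ⊗ h) n ⟨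
    (f ⊗ (g ⊗ h)) (suc n) ∎

  ⊗-zeroˡᵖ : ∀ f n → (zeroPS ⊗ f) n ≡ 0ℚ
  ⊗-zeroˡᵖ f zero = ℚₚ.*-zeroˡ (f 0)
  ⊗-zeroˡᵖ f (suc n) = ≡.trans (⊗-head zeroPS f n)
    (≡.cong₂ ℚ._+_ (ℚₚ.*-zeroˡ (f (suc n))) (⊗-zeroˡᵖ f n))

  ⊗-identityˡᵖ : ∀ f n → (onePS ⊗ f) n ≡ f n
  ⊗-identityˡᵖ f zero = ℚₚ.*-identityˡ (f 0)
  ⊗-identityˡᵖ f (suc n) = ≡.trans (⊗-head onePS f n) (≡.trans
    (≡.cong₂ ℚ._+_ (ℚₚ.*-identityˡ (f (suc n))) (⊗-zeroˡᵖ f n)) (ℚₚ.+-identityʳ _))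

open Convolution

-- A record, so that f and g can be inferred from f ≐ g.
infix 4 _≐_
record _≐_ (f g : PS) : Set where
  constructor pointwise
  field
    at : ∀ n → f n ≡ g n
open _≐_

negatePS : PS → PS
negatePS f n = ℚ.- f n

powerSeriesRing : CommutativeRing 0ℓ 0ℓ
powerSeriesRing = record
  { Carrier = PS
  ; _≈_ = _≐_
  ; _+_ = _⊕_
  ; _*_ = _⊗_
  ; -_ = negatePS
  ; 0# = zeroPS
  ; 1# = onePS
  ; isCommutativeRing = record
    { isRing = record
      { +-isAbelianGroup = record
        { isGroup = record
          { isMonoid = record
            { isSemigroup = record
              { isMagma = record
                { isEquivalence = record
                  { refl = pointwise λ _ → ≡.refl
                  ; sym = λ e → pointwise λ n → ≡.sym (at e n)
                  ; trans = λ e e′ → pointwise λ n → ≡.trans (at e n) (at e′ n)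
                  }
                ; ∙-cong = λ e e′ → pointwise λ n → ≡.cong₂ ℚ._+_ (at e n) (at e′ n)
                }
              ; assoc = λ f g h → pointwise λ n → ℚₚ.+-assoc (f n) (g n) (h n)
              }
            ; identity = (λ f → pointwise λ n → ℚₚ.+-identityˡ (f n)) , (λ f → pointwise λ n → ℚₚ.+-identityʳ (f n))
            }
          ; inverse = (λ f → pointwise λ n → ℚₚ.+-inverseˡ (f n)) , (λ f → pointwise λ n → ℚₚ.+-inverseʳ (f n))
          ; ⁻¹-cong = λ e → pointwise λ n → ≡.cong ℚ.-_ (at e n)
          }
        ; comm = λ f g → pointwise λ n → ℚₚ.+-comm (f n) (g n)
        }
      ; *-cong = λ e e′ → pointwise λ n → ⊗-congᵖ n (λ i _ → at e i) (λ i _ → at e′ i)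
      ; *-assoc = λ f g h → pointwise (⊗-assocᵖ f g h)
      ; *-identity = (λ f → pointwise (⊗-identityˡᵖ f))
          , (λ f → pointwise λ n → ≡.trans (⊗-commᵖ f onePS n) (⊗-identityˡᵖ f n))
      ; distrib = (λ f g h → pointwise λ n → ≡.trans (⊗-commᵖ f (g ⊕ h) n)
            (≡.trans (⊗-distribʳᵖ f g h n) (≡.cong₂ ℚ._+_ (⊗-commᵖ g f n) (⊗-commᵖ h f n))))
          , (λ f g h → pointwise (⊗-distribʳᵖ f g h))
      }
    ; *-comm = λ f g → pointwise (⊗-commᵖ f g)
    }
  }

-- Power series as an instance of the abstract coefficient ring

module PowerSeries where
  open CommutativeRing powerSeriesRing hiding (zero)
  open Solver powerSeriesRing
  open SemiringExp semiring using (_^_)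
  open SetoidReasoning setoid

  q : PS
  q = qpow 1

  q⊗-zero : ∀ f → (q * f) 0 ≡ 0ℚ
  q⊗-zero f = ℚₚ.*-zeroˡ (f 0)

  q⊗-suc : ∀ f n → (q * f) (suc n) ≡ f n
  q⊗-suc f n = ≡.trans (⊗-head q f n) (≡.trans (≡.cong₂ ℚ._+_ (ℚₚ.*-zeroˡ (f (suc n)))
    (≡.trans (⊗-congᵖ n {tail q} {onePS} {f} (λ { zero _ → ≡.refl ; (suc i) _ → ≡.refl }) (λ _ _ → ≡.refl))
      (⊗-identityˡᵖ f n)))
    (ℚₚ.+-identityˡ (f n)))

  qpow≈q^ : ∀ e → qpow e ≈ q ^ e
  qpow≈q^ zero = pointwise λ { zero → ≡.refl ; (suc n) → ≡.refl }
  qpow≈q^ (suc e) = trans (pointwise λ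
    { zero → ≡.sym (q⊗-zero (qpow e))
    ; (suc n) → ≡.sym (q⊗-suc (qpow e) n) }) (*-congˡ {q} (qpow≈q^ e))

  q^-below : ∀ k f {n} → n < k → (q ^ k * f) n ≡ 0ℚ
  q^-below (suc k) f {zero} _ = ≡.trans (at (*-assoc q (q ^ k) f) 0) (q⊗-zero (q ^ k * f))
  q^-below (suc k) f {suc n} (s≤s n<k) = ≡.trans (at (*-assoc q (q ^ k) f) (suc n))
    (≡.trans (q⊗-suc (q ^ k * f) n) (q^-below k f n<k))

  q^-shift : ∀ k f n → (q ^ k * f) (k ℕ.+ n) ≡ f n
  q^-shift zero f n = at (*-identityˡ f) n
  q^-shift (suc k) f n = ≡.trans (at (*-assoc q (q ^ k) f) (suc (k ℕ.+ n)))
    (≡.trans (q⊗-suc (q ^ k * f) (k ℕ.+ n)) (q^-shift k f n))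

  q-cancel : ∀ f → q * f ≈ zeroPS → f ≈ zeroPS
  q-cancel f e = pointwise λ n → ≡.trans (≡.sym (q⊗-suc f n)) (at e (suc n))

  oneMinusQ≈1-q : oneMinusQ ≈ onePS - q
  oneMinusQ≈1-q = pointwise λ { zero → ≡.refl ; (suc zero) → ≡.refl ; (suc (suc n)) → ≡.refl }

  -- The equation characterising 1/(1 - q^(m+1)). Below exponent m + 1 only the constant term
  -- survives; from there on remainders are periodic.
  geom-recurrence : ∀ m → geom (suc m) ≈ onePS + (q ^ suc m * geom (suc m))
  geom-recurrence m = pointwise coefficient
    where
    G : PS
    G = geom (suc m)

    constant-below : ∀ n → n < suc m → G n ≡ onePS n
    constant-below n n<1+m rewrite m<n⇒m%n≡m n<1+m with n
    ... | zero = ≡.refl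
    ... | suc _ = ≡.refl

    periodic : ∀ n → G (suc m ℕ.+ n) ≡ G n
    periodic n rewrite ℕₚ.+-comm (suc m) n | [m+n]%n≡m%n n (suc m) {{_}} = ≡.refl

    coefficient : ∀ n → G n ≡ onePS n ℚ.+ (q ^ suc m * G) n
    coefficient n with ℕₚ.<-≤-connex n (suc m)
    ... | inj₁ n<1+m = ≡.trans (constant-below n n<1+m)
      (≡.sym (≡.trans (≡.cong (onePS n ℚ.+_) (q^-below (suc m) G n<1+m)) (ℚₚ.+-identityʳ _)))
    ... | inj₂ 1+m≤n = ≡.subst (λ n → G n ≡ onePS n ℚ.+ (q ^ suc m * G) n) (ℕₚ.m+[n∸m]≡n 1+m≤n)
      (≡.trans (periodic (n ∸ suc m))
        (≡.sym (≡.trans (ℚₚ.+-identityˡ _) (q^-shift (suc m) G (n ∸ suc m)))))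

  open Bracket powerSeriesRing q

  bracket-invBracket : ∀ m → bracket (suc m) * invBracket (suc m) ≈ onePS
  bracket-invBracket m = begin
    bracket (suc m) * (oneMinusQ * geom (suc m))
      ≈⟨ *-congˡ {bracket (suc m)} (*-congʳ {geom (suc m)} oneMinusQ≈1-q) ⟩
    bracket (suc m) * ((onePS - q) * geom (suc m))
      ≈⟨ solve 3 (λ b q g → b :* ((con (1 , 0) :- q) :* g)
           := g :- (con (1 , 0) :- (con (1 , 0) :- q) :* b) :* g) refl (bracket (suc m)) q (geom (suc m)) ⟩
    geom (suc m) - (onePS - (onePS - q) * bracket (suc m)) * geom (suc m)
      ≈⟨ +-congˡ {geom (suc m)} (-‿cong (*-congʳ {geom (suc m)} (q^≈1-[1-q]bracket (suc m)))) ⟨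
    geom (suc m) - q ^ suc m * geom (suc m)
      ≈⟨ +-congʳ (geom-recurrence m) ⟩
    (onePS + (q ^ suc m * geom (suc m))) - q ^ suc m * geom (suc m)
      ≈⟨ solve 1 (λ x → con (1 , 0) :+ x :- x := con (1 , 0)) refl (q ^ suc m * geom (suc m)) ⟩
    onePS ∎

  constPS-⊗ : ∀ c f → constPS c * f ≈ (λ n → c ℚ.* f n)
  constPS-⊗ c f = pointwise λ
    { zero → ≡.refl
    ; (suc n) → ≡.trans (⊗-head (constPS c) f n)
        (≡.trans (≡.cong (c ℚ.* f (suc n) ℚ.+_) (⊗-zeroˡᵖ f n)) (ℚₚ.+-identityʳ _)) }

  constPS-+ : ∀ a b → constPS (a ℚ.+ b) ≈ constPS a + constPS b
  constPS-+ a b = pointwise λ { zero → ≡.refl ; (suc n) → ≡.refl }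

  constPS-* : ∀ a b → constPS (a ℚ.* b) ≈ constPS a * constPS b
  constPS-* a b = trans (pointwise λ { zero → ≡.refl ; (suc n) → ≡.sym (ℚₚ.*-zeroʳ a) })
    (sym (constPS-⊗ a (constPS b)))

  constPS-0 : constPS 0ℚ ≈ zeroPS
  constPS-0 = pointwise λ { zero → ≡.refl ; (suc n) → ≡.refl }

  constPS-1 : constPS 1ℚ ≈ onePS
  constPS-1 = pointwise λ { zero → ≡.refl ; (suc n) → ≡.refl }

  constPS--1 : constPS (ℚ.- 1ℚ) ≈ - onePS
  constPS--1 = pointwise λ { zero → ≡.refl ; (suc n) → ≡.refl }

  evalPoly-polyAdd : ∀ c d → evalPoly (polyAdd c d) ≈ evalPoly c + evalPoly d
  evalPoly-polyAdd [] d = sym (+-identityˡ (evalPoly d))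
  evalPoly-polyAdd (a ∷ c) [] = sym (+-identityʳ (evalPoly (a ∷ c)))
  evalPoly-polyAdd (a ∷ c) (b ∷ d) = trans (+-cong (constPS-+ a b) (*-congˡ {oneMinusQ} (evalPoly-polyAdd c d)))
    (solve 5 (λ a b h x y → a :+ b :+ h :* (x :+ y) := a :+ h :* x :+ (b :+ h :* y)) refl
      (constPS a) (constPS b) oneMinusQ (evalPoly c) (evalPoly d))

  evalPoly-polyScale : ∀ a c → evalPoly (polyScale a c) ≈ constPS a * evalPoly c
  evalPoly-polyScale a [] = sym (zeroʳ (constPS a))
  evalPoly-polyScale a (b ∷ c) = trans (+-cong (constPS-* a b) (*-congˡ {oneMinusQ} (evalPoly-polyScale a c)))
    (solve 4 (λ a b h x → a :* b :+ h :* (a :* x) := a :* (b :+ h :* x)) refl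
      (constPS a) (constPS b) oneMinusQ (evalPoly c))

  evalPoly-polyMul : ∀ c d → evalPoly (polyMul c d) ≈ evalPoly c * evalPoly d
  evalPoly-polyMul [] d = sym (zeroˡ (evalPoly d))
  evalPoly-polyMul (a ∷ c) d = begin
    evalPoly (polyAdd (polyScale a d) (0ℚ ∷ polyMul c d))
      ≈⟨ evalPoly-polyAdd (polyScale a d) (0ℚ ∷ polyMul c d) ⟩
    evalPoly (polyScale a d) + (constPS 0ℚ + (oneMinusQ * evalPoly (polyMul c d)))
      ≈⟨ +-cong (evalPoly-polyScale a d) (+-cong constPS-0 (*-congˡ {oneMinusQ} (evalPoly-polyMul c d))) ⟩
    (constPS a * evalPoly d) + (zeroPS + (oneMinusQ * (evalPoly c * evalPoly d)))
      ≈⟨ solve 4 (λ a h x y → a :* y :+ (con (0 , 0) :+ h :* (x :* y)) := (a :+ h :* x) :* y) refl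
           (constPS a) oneMinusQ (evalPoly c) (evalPoly d) ⟩
    (constPS a + (oneMinusQ * evalPoly c)) * evalPoly d ∎

  evalPoly-constant : ∀ c → evalPoly (c ∷ []) ≈ constPS c
  evalPoly-constant c = trans (+-congˡ {constPS c} (zeroʳ oneMinusQ)) (+-identityʳ (constPS c))

  evalPoly-pHbar : evalPoly pHbar ≈ onePS - q
  evalPoly-pHbar = trans (+-cong constPS-0 (*-cong oneMinusQ≈1-q (trans (evalPoly-constant 1ℚ) constPS-1)))
    (trans (+-identityˡ ((onePS - q) * onePS)) (*-identityʳ (onePS - q)))

  powPS≈^ : ∀ f k → powPS f k ≈ f ^ k
  powPS≈^ f zero = refl
  powPS≈^ f (suc k) = *-congˡ {f} (powPS≈^ f k)

powerSeriesQRing : QRing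
powerSeriesQRing = record
  { R = powerSeriesRing
  ; q = PowerSeries.q
  ; ι = λ m → invBracket (suc m)
  ; bracket-ι = PowerSeries.bracket-invBracket
  ; q-cancel = PowerSeries.q-cancel
  ; ⟦_⟧ = evalPoly
  ; ⟦⟧-polyMul = PowerSeries.evalPoly-polyMul
  ; ⟦⟧-pOne = trans (PowerSeries.evalPoly-constant 1ℚ) PowerSeries.constPS-1
  ; ⟦⟧-pMinusOne = trans (PowerSeries.evalPoly-constant (ℚ.- 1ℚ)) PowerSeries.constPS--1
  ; ⟦⟧-pHbar = PowerSeries.evalPoly-pHbar
  }
  where open CommutativeRing powerSeriesRing using (trans)

-- Comparison of the zeta series with their truncations

open PowerSeries using (qpow≈q^; q^-below; powPS≈^)
open CommutativeRing powerSeriesRing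
  using (_*_; _≈_; refl; sym; trans; setoid; semiring; commutativeSemiring;
    +-cong; *-cong; *-congˡ; *-assoc; *-comm; *-identityˡ)
open SemiringExp semiring using (_^_; ^-assocʳ)
open CommutativeSemiringExp commutativeSemiring using (^-distrib-*)
open Sums powerSeriesRing
open LinearExtension powerSeriesQRing using (ext)
open NewtonBasis powerSeriesQRing using (p)
open HarmonicSums powerSeriesQRing using (letter; Z)
open Divisibility powerSeriesRing PowerSeries.q using (q^_∣_)
open GeneratingPolynomials powerSeriesQRing using (truncatedZeta; truncated-relation)

-- Regroups q^((k-1)m)/[m]^k as (q^m/[m])^(k-1) times 1/[m]. At k = 0 the truncated exponent is 0
-- and both sides are 1.
letter-series : ∀ k b → qpow ((k ∸ 1) ℕ.* suc b) ⊗ powPS (invBracket (suc b)) k ≈ letter k b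
letter-series zero b = trans (*-cong (qpow≈q^ 0) (refl {onePS})) (*-identityˡ onePS)
letter-series (suc k) b = begin
  qpow (k ℕ.* suc b) * (ι * powPS ι k)
    ≈⟨ *-cong (trans (qpow≈q^ (k ℕ.* suc b)) exponent) (*-congˡ {ι} (powPS≈^ ι k)) ⟩
  (Q ^ k) * (ι * (ι ^ k))
    ≈⟨ *-congˡ {Q ^ k} (*-comm ι (ι ^ k)) ⟩
  (Q ^ k) * ((ι ^ k) * ι)
    ≈⟨ *-assoc (Q ^ k) (ι ^ k) ι ⟨
  ((Q ^ k) * (ι ^ k)) * ι
    ≈⟨ *-cong (^-distrib-* Q ι k) (refl {ι}) ⟨
  ((Q * ι) ^ k) * ι ∎
  where
  open SetoidReasoning setoid
  ι Q : PS
  ι = invBracket (suc b)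
  Q = PowerSeries.q ^ suc b
  exponent : PowerSeries.q ^ (k ℕ.* suc b) ≈ Q ^ k
  exponent = ≡.subst (λ e → PowerSeries.q ^ e ≈ Q ^ k) (ℕₚ.*-comm (suc b) k) (sym (^-assocʳ PowerSeries.q (suc b) k))

Zb≈Z : ∀ w b → Zb w b ≈ Z w b
Zb≈Z [] b = refl
Zb≈Z (k ∷ w) zero = refl
Zb≈Z (k ∷ w) (suc b) = +-cong (Zb≈Z (k ∷ w) b) (*-cong (letter-series k b) (Zb≈Z w b))

infix 4 _≡[_]_
_≡[_]_ : PS → ℕ → PS → Set
f ≡[ M ] g = ∀ n → n ≤ M → f n ≡ g n

⊗-agree : ∀ {M f f′ g g′} → f ≡[ M ] f′ → g ≡[ M ] g′ → f ⊗ g ≡[ M ] f′ ⊗ g′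
⊗-agree {f = f} {f′} {g} {g′} f≡f′ g≡g′ n n≤M = ⊗-congᵖ n {f} {f′} {g} {g′}
  (λ i i≤n → f≡f′ i (ℕₚ.≤-trans i≤n n≤M)) (λ i i≤n → g≡g′ i (ℕₚ.≤-trans i≤n n≤M))

⊕-agree : ∀ {M f f′ g g′} → f ≡[ M ] f′ → g ≡[ M ] g′ → f ⊕ g ≡[ M ] f′ ⊕ g′
⊕-agree f≡f′ g≡g′ n n≤M = ≡.cong₂ ℚ._+_ (f≡f′ n n≤M) (g≡g′ n n≤M)

HeadAtLeast2 : Word → Set
HeadAtLeast2 [] = ⊥
HeadAtLeast2 (k ∷ w) = 2 ≤ k

-- For k ≥ 2 the terms added at the index b + 1 begin at exponent (k-1)(b+1), which exceeds n.
Zb-stable : ∀ k w → 2 ≤ k → ∀ {n b} → n ℕ.≤′ b → Zb (k ∷ w) b n ≡ Zb (k ∷ w) n n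
Zb-stable k w 2≤k (ℕ.≤′-reflexive ≡.refl) = ≡.refl
Zb-stable k w 2≤k {n} {suc b} (ℕ.≤′-step n≤′b) = ≡.trans
  (≡.cong₂ ℚ._+_ (Zb-stable k w 2≤k n≤′b) vanishing) (ℚₚ.+-identityʳ _)
  where
  e : ℕ
  e = (k ∸ 1) ℕ.* suc b
  I : PS
  I = powPS (invBracket (suc b)) k
  n<e : n < e
  n<e = ℕₚ.≤-trans (s≤s (ℕₚ.≤′⇒≤ n≤′b))
    (ℕₚ.≤-trans (ℕₚ.≤-reflexive (≡.sym (ℕₚ.*-identityˡ (suc b)))) (ℕₚ.*-monoˡ-≤ (suc b) (ℕₚ.∸-monoˡ-≤ 1 2≤k)))
  vanishing : ((qpow e ⊗ I) ⊗ Zb w b) n ≡ 0ℚ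
  vanishing = ≡.trans (at (*-assoc (qpow e) I (Zb w b)) n)
    (≡.trans (at (*-cong (qpow≈q^ e) (refl {I ⊗ Zb w b})) n) (q^-below e (I ⊗ Zb w b) n<e))

zetaW-agree : ∀ M w → HeadAtLeast2 w → zetaW w ≡[ M ] Z w M
zetaW-agree M (suc (suc k) ∷ w) 2≤k n n≤M =
  ≡.trans (≡.sym (Zb-stable (suc (suc k)) w 2≤k (ℕₚ.≤⇒≤′ n≤M))) (at (Zb≈Z (suc (suc k) ∷ w) M) n)
zetaW-agree M (suc zero ∷ w) (s≤s ())

zetaq-agree : ∀ M h → AllWords HeadAtLeast2 h → zetaq h ≡[ M ] ext (λ w → Z w M) h
zetaq-agree M [] [] n n≤M = ≡.refl
zetaq-agree M ((c , w) ∷ h) (x ∷ xs) = ⊕-agree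
  {f = evalPoly c ⊗ zetaW w} {f′ = evalPoly c ⊗ Z w M} {g = zetaq h} {g′ = ext (λ w → Z w M) h}
  (⊗-agree {f = evalPoly c} {evalPoly c} {zetaW w} {Z w M} (λ _ _ → ≡.refl) (zetaW-agree M w x)) (zetaq-agree M h xs)

-- The first letter is a sum of two positive letters, so `zetaW` is evaluated on convergent words
-- and its default value never arises.
circledastW-head : ∀ u v → Positive u → ValidWord v → AllWords HeadAtLeast2 (circledastW u v)
circledastW-head (i ∷ u) [] _ _ = []
circledastW-head (i ∷ u) (j ∷ v) (_ , 1≤i ∷ _) (1≤j ∷ _) =
  allWords-prefixH {S = λ _ → ⊤} (i ℕ.+ j) (starPlusW u v) (λ _ _ → ℕₚ.+-mono-≤ 1≤i 1≤j) (All.universal (λ _ → tt) _)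

zeta-agree : ∀ M h n → InH1pos h → zetaq (circledast (d (phi h)) (z1pow n)) ≡[ M ] truncatedZeta M h n
zeta-agree M h n pos = zetaq-agree M _
  (allWords-bilin (d (phi h)) (z1pow n) circledastW-head (dφ-positive h pos) (replicate-valid n ∷ []))

sumPS≈∑ : ∀ n (f : ℕ → PS) (g : ℕ → ℕ) → sumPS (map f (applyUpTo g n)) ≈ ∑ n (f ∘ g)
sumPS≈∑ zero f g = refl
sumPS≈∑ (suc n) f g = trans (+-cong (refl {f (g 0)}) (sumPS≈∑ n f (g ∘ suc))) (sym (∑-head n (f ∘ g)))

∑-agree : ∀ {M} n {f g : ℕ → PS} → (∀ i → f i ≡[ M ] g i) → ∑ n f ≡[ M ] ∑ n g
∑-agree zero f≡g _ _ = ≡.refl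
∑-agree (suc n) {f} {g} f≡g = ⊕-agree {f = ∑ n f} {∑ n g} {f n} {g n} (∑-agree n f≡g) (f≡g n)

theorem4p6 : (w₁ w₂ : H) → InH1pos w₁ → InH1pos w₂ → (n : ℕ) → 1 ≤ n →
    (N : ℕ) →
    (zetaq (circledast (d (phi (starBar w₁ w₂))) (z1pow n))
    ⊕ sumFrom1Below n (λ k →
    zetaq (circledast (d (phi w₁)) (z1pow k))
    ⊗ zetaq (circledast (d (phi w₂)) (z1pow (n ∸ k))))) N ≡ 0ℚ
theorem4p6 w₁ w₂ pos₁ pos₂ (suc n) _ N = begin
  (zeta w₁₂ (suc n) ⊕ sumPS (map f (upTo n))) N
    ≡⟨ ≡.cong (zeta w₁₂ (suc n) N ℚ.+_) (at (sumPS≈∑ n f (λ i → i)) N) ⟩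
  (zeta w₁₂ (suc n) ⊕ ∑ n f) N
    -- The truncation bound is the exponent N under inspection: truncation at N preserves the
    -- coefficients up to q^N, and divisibility by q^(N+1) makes this one vanish.
    ≡⟨ ⊕-agree {f = zeta w₁₂ (suc n)} {truncatedZeta N w₁₂ (suc n)} {∑ n f} {∑ n g}
         (zeta-agree N w₁₂ (suc n) (starBar-positive w₁ w₂ pos₁ pos₂))
         (∑-agree n λ k → ⊗-agree {f = zeta w₁ (suc k)} {truncatedZeta N w₁ (suc k)}
           {zeta w₂ (n ∸ k)} {truncatedZeta N w₂ (n ∸ k)}
           (zeta-agree N w₁ (suc k) pos₁) (zeta-agree N w₂ (n ∸ k) pos₂)) N ℕₚ.≤-refl ⟩
  (truncatedZeta N w₁₂ (suc n) ⊕ ∑ n g) N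
    ≡⟨ at (proj₂ divisible) N ⟩
  (PowerSeries.q ^ suc N * proj₁ divisible) N
    ≡⟨ q^-below (suc N) (proj₁ divisible) (ℕₚ.n<1+n N) ⟩
  0ℚ ∎
  where
  open ≡.≡-Reasoning
  w₁₂ : H
  w₁₂ = starBar w₁ w₂
  zeta : H → ℕ → PS
  zeta h m = zetaq (circledast (d (phi h)) (z1pow m))
  f g : ℕ → PS
  f k = zeta w₁ (suc k) ⊗ zeta w₂ (n ∸ k)
  g k = truncatedZeta N w₁ (suc k) ⊗ truncatedZeta N w₂ (n ∸ k)
  divisible : q^ suc N ∣ truncatedZeta N w₁₂ (suc n) ⊕ ∑ n g
  divisible = truncated-relation N w₁ w₂ pos₁ pos₂ n
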